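{- For each integer $m\ge2$ let $r=\frac1{4m}$ and, for real $v$, let $$\Psi_r(v)=\frac{1+v-\sqrt{(1-v)^2+4r}}{2}=\frac{1+v-\sqrt{(1-v)^2+\frac1m}}{2}.$$ Let $(w_k)_{k\ge0}$ be defined by $w_0=\frac12$, $w_{k+1}=\Psi_r(w_k)$, and set $$p_\top(m):=\prod_{k=0}^{m-2}\partial_v\Psi_r(w_k).$$ Then $p_\top(m)\to\frac{1}{\sqrt3}$ as $m\to\infty$.
   Context: Here $\partial_v\Psi_r(v)=\frac12\left(1+\frac{1-v}{\sqrt{(1-v)^2+1/m}}\right)$ is the derivative of $\Psi_r$ with respect to $v$. The sequence $(w_k)$ depends on $m$ through $r$. -}

module Defs where

open import Data.Bool.Base using (T; true; false; if_then_else_)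
open import Data.Empty using (⊥-elim)
open import Data.Integer.Base as ℤ using (ℤ; +_; -[1+_]; +[1+_])
import Data.Integer.DivMod as ℤ
import Data.Integer.Properties as ℤ
open import Data.Nat.Base as ℕ using (ℕ; zero; suc; NonTrivial)
import Data.Nat.Coprimality as Coprime
import Data.Nat.Properties as ℕ
open import Data.Product.Base using (∃-syntax; _×_; _,_; proj₁; proj₂)
open import Data.Rational.Base as ℚ using (ℚ; mkℚ; 0ℚ; 1ℚ; ½; ↥_; ↧_; *≤*; *<*)
import Data.Rational.Properties as ℚ
open import Data.Rational.Solver using (module +-*-Solver)
open import Data.Sum.Base using (inj₁; inj₂; [_,_]′)
open import Relation.Binary.PropositionalEquality
  using (_≡_; _≢_; refl; sym; trans; cong; cong₂; subst; subst₂)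
open import Relation.Nullary.Decidable using (yes; no)

Eventually : (ℕ → Set) → Set
Eventually P = ∃[ N ] (∀ n → N ℕ.≤ n → P n)

module _ where
  open ℚ.≤-Reasoning
  open +-*-Solver

  *-≥0 : ∀ {p q} → 0ℚ ℚ.≤ p → 0ℚ ℚ.≤ q → 0ℚ ℚ.≤ p ℚ.* q
  *-≥0 {p} {q} 0≤p 0≤q = ℚ.nonNegative⁻¹ (p ℚ.* q)
    {{ℚ.nonNeg*nonNeg⇒nonNeg p {{ℚ.nonNegative 0≤p}} q {{ℚ.nonNegative 0≤q}}}}

  *->0 : ∀ {p q} → 0ℚ ℚ.< p → 0ℚ ℚ.< q → 0ℚ ℚ.< p ℚ.* q
  *->0 {p} {q} 0<p 0<q = ℚ.positive⁻¹ (p ℚ.* q)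
    {{ℚ.pos*pos⇒pos p {{ℚ.positive 0<p}} q {{ℚ.positive 0<q}}}}

  *-mono : ∀ {p q r s} → 0ℚ ℚ.≤ p → 0ℚ ℚ.≤ s → p ℚ.≤ q → r ℚ.≤ s → p ℚ.* r ℚ.≤ q ℚ.* s
  *-mono {p} {q} {r} {s} 0≤p 0≤s p≤q r≤s = begin
    p ℚ.* r ≤⟨ ℚ.*-monoˡ-≤-nonNeg p {{ℚ.nonNegative 0≤p}} r≤s ⟩
    p ℚ.* s ≤⟨ ℚ.*-monoʳ-≤-nonNeg s {{ℚ.nonNegative 0≤s}} p≤q ⟩
    q ℚ.* s ∎

  square≥0 : ∀ p → 0ℚ ℚ.≤ p ℚ.* p
  square≥0 p = [ (λ 0≤p → *-≥0 0≤p 0≤p)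
               , (λ p≤0 → subst (0ℚ ℚ.≤_) (solve 1 (λ p → (:- p) :* (:- p) := p :* p) refl p)
                   (*-≥0 (ℚ.neg-antimono-≤ p≤0) (ℚ.neg-antimono-≤ p≤0))) ]′ (ℚ.≤-total 0ℚ p)

  square-cancel-< : ∀ {p q} → 0ℚ ℚ.≤ p → 0ℚ ℚ.≤ q → p ℚ.* p ℚ.< q ℚ.* q → p ℚ.< q
  square-cancel-< {p} {q} 0≤p 0≤q lt with p ℚ.<? q
  ... | yes p<q = p<q
  ... | no  p≮q = ⊥-elim (ℚ.<-irrefl refl (ℚ.<-≤-trans lt (*-mono 0≤q 0≤p (ℚ.≮⇒≥ p≮q) (ℚ.≮⇒≥ p≮q))))

  half>0 : ∀ {p} → 0ℚ ℚ.< p → 0ℚ ℚ.< ½ ℚ.* p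
  half>0 = *->0 (ℚ.positive⁻¹ ½)

  halves : ∀ p → ½ ℚ.* p ℚ.+ ½ ℚ.* p ≡ p
  halves = solve 1 (λ p → con ½ :* p :+ con ½ :* p := p) refl

  p≤∣p∣ : ∀ p → p ℚ.≤ ℚ.∣ p ∣
  p≤∣p∣ p = [ (λ 0≤p → ℚ.≤-reflexive (sym (ℚ.0≤p⇒∣p∣≡p 0≤p)))
            , (λ p≤0 → ℚ.≤-trans p≤0 (ℚ.0≤∣p∣ p)) ]′ (ℚ.≤-total 0ℚ p)

  ∣∣-≤ : ∀ {p e} → p ℚ.≤ e → ℚ.- p ℚ.≤ e → ℚ.∣ p ∣ ℚ.≤ e
  ∣∣-≤ {p} p≤e -p≤e with ℚ.∣p∣≡p∨∣p∣≡-p p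
  ... | inj₁ eq = ℚ.≤-trans (ℚ.≤-reflexive eq) p≤e
  ... | inj₂ eq = ℚ.≤-trans (ℚ.≤-reflexive eq) -p≤e

  ∣-∣-sym : ∀ p q → ℚ.∣ p ℚ.- q ∣ ≡ ℚ.∣ q ℚ.- p ∣
  ∣-∣-sym p q = trans (sym (ℚ.∣-p∣≡∣p∣ (p ℚ.- q)))
    (cong ℚ.∣_∣ (solve 2 (λ p q → :- (p :- q) := q :- p) refl p q))

  ≤+⇒-≤ : ∀ {p q e} → p ℚ.≤ q ℚ.+ e → p ℚ.- q ℚ.≤ e
  ≤+⇒-≤ {p} {q} {e} le = begin
    p ℚ.- q           ≤⟨ ℚ.+-monoˡ-≤ (ℚ.- q) le ⟩
    q ℚ.+ e ℚ.- q     ≡⟨ solve 2 (λ q e → q :+ e :- q := e) refl q e ⟩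
    e                 ∎

  -≤⇒≤+ : ∀ {p q e} → p ℚ.- q ℚ.≤ e → p ℚ.≤ q ℚ.+ e
  -≤⇒≤+ {p} {q} {e} le = begin
    p                 ≡⟨ solve 2 (λ p q → p := q :+ (p :- q)) refl p q ⟩
    q ℚ.+ (p ℚ.- q)   ≤⟨ ℚ.+-monoʳ-≤ q le ⟩
    q ℚ.+ e           ∎

  ∣-∣-≤ : ∀ {p q e} → p ℚ.≤ q ℚ.+ e → q ℚ.≤ p ℚ.+ e → ℚ.∣ p ℚ.- q ∣ ℚ.≤ e
  ∣-∣-≤ {p} {q} p≤ q≤ = ∣∣-≤ (≤+⇒-≤ p≤)
    (subst (ℚ._≤ _) (solve 2 (λ p q → q :- p := :- (p :- q)) refl p q) (≤+⇒-≤ q≤))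

  ∣-∣-≤⁻¹ : ∀ {p q e} → ℚ.∣ p ℚ.- q ∣ ℚ.≤ e → p ℚ.≤ q ℚ.+ e
  ∣-∣-≤⁻¹ le = -≤⇒≤+ (ℚ.≤-trans (p≤∣p∣ _) le)

-- Only eventually positive sequences are inverted, so the value at 0 is irrelevant.
inverseℚ : ℚ → ℚ
inverseℚ q with q ℚ.≟ 0ℚ
... | yes _   = 0ℚ
... | no  q≢0 = (ℚ.1/ q) {{ℚ.≢-nonZero q≢0}}

module _ where
  open ℚ.≤-Reasoning
  open +-*-Solver

  inverseℚ-correct : ∀ {q} → 0ℚ ℚ.< q → q ℚ.* inverseℚ q ≡ 1ℚ
  inverseℚ-correct {q} 0<q with q ℚ.≟ 0ℚ
  ... | yes q≡0 = ⊥-elim (ℚ.<⇒≢ 0<q (sym q≡0))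
  ... | no  q≢0 = ℚ.*-inverseʳ q {{ℚ.≢-nonZero q≢0}}

  inverseℚ>0 : ∀ {q} → 0ℚ ℚ.< q → 0ℚ ℚ.< inverseℚ q
  inverseℚ>0 {q} 0<q with inverseℚ q ℚ.≤? 0ℚ
  ... | no  ≰0 = ℚ.≰⇒> ≰0
  ... | yes ≤0 = ⊥-elim (ℚ.<-irrefl refl (begin-strict
    0ℚ                    <⟨ ℚ.positive⁻¹ 1ℚ ⟩
    1ℚ                    ≡⟨ sym (inverseℚ-correct 0<q) ⟩
    q ℚ.* inverseℚ q      ≤⟨ ℚ.*-monoˡ-≤-nonNeg q {{ℚ.nonNegative (ℚ.<⇒≤ 0<q)}} ≤0 ⟩
    q ℚ.* 0ℚ              ≡⟨ ℚ.*-zeroʳ q ⟩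
    0ℚ                    ∎))

  inverseℚ-close : ∀ {a b d e} → 0ℚ ℚ.< d → 0ℚ ℚ.≤ e → d ℚ.≤ a → d ℚ.≤ b →
                   ℚ.∣ a ℚ.- b ∣ ℚ.≤ e ℚ.* (d ℚ.* d) →
                   ℚ.∣ inverseℚ a ℚ.- inverseℚ b ∣ ℚ.≤ e
  inverseℚ-close {a} {b} {d} {e} 0<d 0≤e d≤a d≤b le = begin
    ℚ.∣ i ℚ.- j ∣                               ≡⟨ cong ℚ.∣_∣ i-j ⟩
    ℚ.∣ (b ℚ.- a) ℚ.* (i ℚ.* j) ∣               ≡⟨ ℚ.∣p*q∣≡∣p∣*∣q∣ (b ℚ.- a) (i ℚ.* j) ⟩
    ℚ.∣ b ℚ.- a ∣ ℚ.* ℚ.∣ i ℚ.* j ∣             ≡⟨ cong₂ ℚ._*_ (∣-∣-sym b a) (ℚ.0≤p⇒∣p∣≡p 0≤ij) ⟩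
    ℚ.∣ a ℚ.- b ∣ ℚ.* (i ℚ.* j)                 ≤⟨ ℚ.*-monoʳ-≤-nonNeg (i ℚ.* j) {{ℚ.nonNegative 0≤ij}} le ⟩
    e ℚ.* (d ℚ.* d) ℚ.* (i ℚ.* j)               ≡⟨ solve 4 (λ e d i j → e :* (d :* d) :* (i :* j) := e :* ((d :* i) :* (d :* j))) refl e d i j ⟩
    e ℚ.* ((d ℚ.* i) ℚ.* (d ℚ.* j))             ≤⟨ ℚ.*-monoˡ-≤-nonNeg e {{ℚ.nonNegative 0≤e}}
                                                     (*-mono (*-≥0 0≤d 0≤i) (ℚ.nonNegative⁻¹ 1ℚ)
                                                       (d*≤1 0<a d≤a) (d*≤1 0<b d≤b)) ⟩
    e ℚ.* (1ℚ ℚ.* 1ℚ)                           ≡⟨ solve 1 (λ e → e :* (con 1ℚ :* con 1ℚ) := e) refl e ⟩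
    e                                           ∎
    where
    i = inverseℚ a
    j = inverseℚ b
    0<a = ℚ.<-≤-trans 0<d d≤a
    0<b = ℚ.<-≤-trans 0<d d≤b
    0≤d = ℚ.<⇒≤ 0<d
    0≤i = ℚ.<⇒≤ (inverseℚ>0 0<a)
    0≤j = ℚ.<⇒≤ (inverseℚ>0 0<b)
    0≤ij = *-≥0 0≤i 0≤j
    d*≤1 : ∀ {x} → 0ℚ ℚ.< x → d ℚ.≤ x → d ℚ.* inverseℚ x ℚ.≤ 1ℚ
    d*≤1 {x} 0<x d≤x = ℚ.≤-trans
      (ℚ.*-monoʳ-≤-nonNeg (inverseℚ x) {{ℚ.nonNegative (ℚ.<⇒≤ (inverseℚ>0 0<x))}} d≤x)
      (ℚ.≤-reflexive (inverseℚ-correct 0<x))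
    i-j : i ℚ.- j ≡ (b ℚ.- a) ℚ.* (i ℚ.* j)
    i-j = begin-equality
      i ℚ.- j                                            ≡⟨ solve 2 (λ i j → i :- j := con 1ℚ :* i :- con 1ℚ :* j) refl i j ⟩
      1ℚ ℚ.* i ℚ.- 1ℚ ℚ.* j                              ≡⟨ cong₂ (λ s t → s ℚ.* i ℚ.- t ℚ.* j)
                                                              (sym (inverseℚ-correct 0<b)) (sym (inverseℚ-correct 0<a)) ⟩
      (b ℚ.* j) ℚ.* i ℚ.- (a ℚ.* i) ℚ.* j                ≡⟨ solve 4 (λ a b i j → b :* j :* i :- a :* i :* j := (b :- a) :* (i :* j)) refl a b i j ⟩
      (b ℚ.- a) ℚ.* (i ℚ.* j)                            ∎

  *-close : ∀ {a b c d A B ε} → 0ℚ ℚ.< A → 0ℚ ℚ.< B → 0ℚ ℚ.< ε →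
            let δ = ε ℚ.* inverseℚ (A ℚ.+ B) in
            ℚ.∣ a ∣ ℚ.≤ A → ℚ.∣ d ∣ ℚ.≤ B → ℚ.∣ a ℚ.- c ∣ ℚ.≤ δ → ℚ.∣ b ℚ.- d ∣ ℚ.≤ δ →
            ℚ.∣ a ℚ.* b ℚ.- c ℚ.* d ∣ ℚ.≤ ε
  *-close {a} {b} {c} {d} {A} {B} {ε} 0<A 0<B 0<ε a≤A d≤B a-c≤δ b-d≤δ = begin
    ℚ.∣ a ℚ.* b ℚ.- c ℚ.* d ∣
      ≡⟨ cong ℚ.∣_∣ (solve 4 (λ a b c d → a :* b :- c :* d := a :* (b :- d) :+ d :* (a :- c)) refl a b c d) ⟩
    ℚ.∣ a ℚ.* (b ℚ.- d) ℚ.+ d ℚ.* (a ℚ.- c) ∣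
      ≤⟨ ℚ.∣p+q∣≤∣p∣+∣q∣ (a ℚ.* (b ℚ.- d)) (d ℚ.* (a ℚ.- c)) ⟩
    ℚ.∣ a ℚ.* (b ℚ.- d) ∣ ℚ.+ ℚ.∣ d ℚ.* (a ℚ.- c) ∣
      ≡⟨ cong₂ ℚ._+_ (ℚ.∣p*q∣≡∣p∣*∣q∣ a (b ℚ.- d)) (ℚ.∣p*q∣≡∣p∣*∣q∣ d (a ℚ.- c)) ⟩
    ℚ.∣ a ∣ ℚ.* ℚ.∣ b ℚ.- d ∣ ℚ.+ ℚ.∣ d ∣ ℚ.* ℚ.∣ a ℚ.- c ∣
      ≤⟨ ℚ.+-mono-≤ (*-mono (ℚ.0≤∣p∣ a) 0≤δ a≤A b-d≤δ) (*-mono (ℚ.0≤∣p∣ d) 0≤δ d≤B a-c≤δ) ⟩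
    A ℚ.* (ε ℚ.* i) ℚ.+ B ℚ.* (ε ℚ.* i)
      ≡⟨ solve 4 (λ A B e i → A :* (e :* i) :+ B :* (e :* i) := e :* ((A :+ B) :* i)) refl A B ε i ⟩
    ε ℚ.* ((A ℚ.+ B) ℚ.* i)
      ≡⟨ cong (ε ℚ.*_) (inverseℚ-correct 0<A+B) ⟩
    ε ℚ.* 1ℚ
      ≡⟨ ℚ.*-identityʳ ε ⟩
    ε ∎
    where
    i = inverseℚ (A ℚ.+ B)
    0<A+B : 0ℚ ℚ.< A ℚ.+ B
    0<A+B = ℚ.+-mono-< 0<A 0<B
    0≤δ : 0ℚ ℚ.≤ ε ℚ.* i
    0≤δ = ℚ.<⇒≤ (*->0 0<ε (inverseℚ>0 0<A+B))

fromℕ : ℕ → ℚ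
fromℕ n = + n ℚ./ 1

1/suc : ℕ → ℚ
1/suc n = + 1 ℚ./ suc n

⌊√_⌋ : ℕ → ℕ
⌊√ zero  ⌋ = 0
⌊√ suc n ⌋ = if suc ⌊√ n ⌋ ℕ.* suc ⌊√ n ⌋ ℕ.≤ᵇ suc n then suc ⌊√ n ⌋ else ⌊√ n ⌋

-- ⌊√⌊q⁺(n+1)²⌋⌋ / (n+1), where q⁺ = max(q,0): an approximation of √q⁺ from below,
-- less than 1/(n+1) away. Opaque because unfolding it stalls the type checker.
opaque
  √ℚ : ℕ → ℚ → ℚ
  √ℚ n q = fromℕ ⌊√ ℤ.∣ ℚ.floor ((q ℚ.⊔ 0ℚ) ℚ.* (fromℕ (suc n) ℚ.* fromℕ (suc n))) ∣ ⌋ ℚ.* 1/suc n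

  √ℚ-unfold : ∀ n q → √ℚ n q ≡
    fromℕ ⌊√ ℤ.∣ ℚ.floor ((q ℚ.⊔ 0ℚ) ℚ.* (fromℕ (suc n) ℚ.* fromℕ (suc n))) ∣ ⌋ ℚ.* 1/suc n
  √ℚ-unfold n q = refl

module _ where
  open ℚ.≤-Reasoning
  open +-*-Solver

  ⌊√⌋-lower : ∀ n → ⌊√ n ⌋ ℕ.* ⌊√ n ⌋ ℕ.≤ n
  ⌊√⌋-lower zero = ℕ.z≤n
  ⌊√⌋-lower (suc n) with suc ⌊√ n ⌋ ℕ.* suc ⌊√ n ⌋ ℕ.≤ᵇ suc n in eq
  ... | true  = ℕ.≤ᵇ⇒≤ _ _ (subst T (sym eq) _)
  ... | false = ℕ.m≤n⇒m≤1+n (⌊√⌋-lower n)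

  ⌊√⌋-upper : ∀ n → n ℕ.< suc ⌊√ n ⌋ ℕ.* suc ⌊√ n ⌋
  ⌊√⌋-upper zero = ℕ.s≤s ℕ.z≤n
  ⌊√⌋-upper (suc n) with suc ⌊√ n ⌋ ℕ.* suc ⌊√ n ⌋ ℕ.≤ᵇ suc n in eq
  ... | true  = ℕ.≤-<-trans (⌊√⌋-upper n) (ℕ.*-mono-< (ℕ.n<1+n (suc ⌊√ n ⌋)) (ℕ.n<1+n (suc ⌊√ n ⌋)))
  ... | false = ℕ.≰⇒> λ le → subst T eq (ℕ.≤⇒≤ᵇ le)

  fromℕ≡ : ∀ n → fromℕ n ≡ mkℚ (+ n) 0 (Coprime.sym (Coprime.1-coprimeTo n))
  fromℕ≡ n = ℚ.↥p/↧p≡p (mkℚ (+ n) 0 _)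

  1/suc≡ : ∀ n → 1/suc n ≡ mkℚ (+ 1) n (Coprime.1-coprimeTo (suc n))
  1/suc≡ n = ℚ.↥p/↧p≡p (mkℚ (+ 1) n _)

  fromℕ-mono-≤ : ∀ m n → m ℕ.≤ n → fromℕ m ℚ.≤ fromℕ n
  fromℕ-mono-≤ m n m≤n = subst₂ ℚ._≤_ (sym (fromℕ≡ m)) (sym (fromℕ≡ n))
    (*≤* (ℤ.*-monoʳ-≤-nonNeg (+ 1) (ℤ.+≤+ m≤n)))

  fromℕ≥0 : ∀ n → 0ℚ ℚ.≤ fromℕ n
  fromℕ≥0 n = fromℕ-mono-≤ 0 n ℕ.z≤n

  fromℕ-+ : ∀ m n → fromℕ (m ℕ.+ n) ≡ fromℕ m ℚ.+ fromℕ n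
  fromℕ-+ m n = sym (trans (cong₂ ℚ._+_ (fromℕ≡ m) (fromℕ≡ n))
    (cong (ℚ._/ 1) (cong₂ ℤ._+_ (ℤ.*-identityʳ (+ m)) (ℤ.*-identityʳ (+ n)))))

  fromℕ-* : ∀ m n → fromℕ (m ℕ.* n) ≡ fromℕ m ℚ.* fromℕ n
  fromℕ-* m n = sym (trans (cong₂ ℚ._*_ (fromℕ≡ m) (fromℕ≡ n))
    (cong (ℚ._/ 1) (sym (ℤ.pos-* m n))))

  1/suc>0 : ∀ n → 0ℚ ℚ.< 1/suc n
  1/suc>0 n = subst (0ℚ ℚ.<_) (sym (1/suc≡ n)) (ℚ.positive⁻¹ (mkℚ (+ 1) n _))

  1/suc-inverse : ∀ n → fromℕ (suc n) ℚ.* 1/suc n ≡ 1ℚ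
  1/suc-inverse n = trans (cong₂ ℚ._*_ (fromℕ≡ (suc n)) (1/suc≡ n))
    (ℚ.*-inverseʳ (mkℚ (+ suc n) 0 (Coprime.sym (Coprime.1-coprimeTo (suc n)))))

  1/suc-small : ∀ {e} → 0ℚ ℚ.< e → Eventually (λ n → 1/suc n ℚ.≤ e)
  1/suc-small {mkℚ +[1+ a ] d c} _ = d , λ n d≤n → subst (ℚ._≤ _) (sym (1/suc≡ n))
    (*≤* (subst (ℤ._≤ +[1+ a ] ℤ.* + suc n) (sym (ℤ.*-identityˡ (+ suc d)))
      (ℤ.+≤+ (ℕ.≤-trans (ℕ.s≤s d≤n) (ℕ.m≤n*m (suc n) (suc a))))))
  1/suc-small {mkℚ (+ 0)    d c} 0<e = ⊥-elim (ℤ.<-irrefl refl (ℚ.drop-*<* 0<e))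
  1/suc-small {mkℚ -[1+ a ] d c} (*<* ())

  ∣floor∣ : ∀ q → 0ℚ ℚ.≤ q → + ℤ.∣ ℚ.floor q ∣ ≡ ℚ.floor q
  ∣floor∣ q@record{} 0≤q = ℤ.0≤i⇒+∣i∣≡i (ℤ.0≤n⇒0≤n/d (↥ q) (↧ q)
    (subst (ℤ._≤ ↥ q) refl (ℤ.nonNegative⁻¹ (↥ q) {{ℚ.nonNegative 0≤q}})) (ℤ.+≤+ ℕ.z≤n))

  floor-lower : ∀ q → 0ℚ ℚ.≤ q → fromℕ ℤ.∣ ℚ.floor q ∣ ℚ.≤ q
  floor-lower q@record{} 0≤q = subst (ℚ._≤ q) (sym (fromℕ≡ ℤ.∣ ℚ.floor q ∣))
    (*≤* (subst₂ ℤ._≤_ (cong (ℤ._* ↧ q) (sym (∣floor∣ q 0≤q))) (sym (ℤ.*-identityʳ (↥ q)))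
      (ℤ.[n/d]*d≤n (↥ q) (↧ q))))

  floor-upper : ∀ q → 0ℚ ℚ.≤ q → q ℚ.< fromℕ (suc ℤ.∣ ℚ.floor q ∣)
  floor-upper q@record{} 0≤q = subst (q ℚ.<_) (sym (fromℕ≡ (suc ℤ.∣ ℚ.floor q ∣)))
    (*<* (subst₂ ℤ._<_ (sym (ℤ.*-identityʳ (↥ q)))
      (cong (λ z → ℤ.suc z ℤ.* ↧ q)
        (trans (sym (ℤ.div-pos-is-/ℕ (↥ q) (ℚ.↧ₙ q))) (sym (∣floor∣ q 0≤q))))
      (ℤ.n<s[n/ℕd]*d (↥ q) (ℚ.↧ₙ q))))

  √ℚ≥0 : ∀ n q → 0ℚ ℚ.≤ √ℚ n q
  √ℚ≥0 n q = subst (0ℚ ℚ.≤_) (sym (√ℚ-unfold n q))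
    (*-≥0 (fromℕ≥0 ⌊√ ℤ.∣ ℚ.floor ((q ℚ.⊔ 0ℚ) ℚ.* (fromℕ (suc n) ℚ.* fromℕ (suc n))) ∣ ⌋) (ℚ.<⇒≤ (1/suc>0 n)))

  module _ (n : ℕ) (q : ℚ) where
    private
      q⁺ = q ℚ.⊔ 0ℚ
      K = fromℕ (suc n)
      e = 1/suc n
      t = q⁺ ℚ.* (K ℚ.* K)
      F = ℤ.∣ ℚ.floor t ∣
      k = ⌊√ F ⌋
      0≤q⁺ : 0ℚ ℚ.≤ q⁺
      0≤q⁺ = ℚ.p≤q⊔p q 0ℚ
      0≤t : 0ℚ ℚ.≤ t
      0≤t = *-≥0 0≤q⁺ (square≥0 K)
      0<ee : 0ℚ ℚ.< e ℚ.* e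
      0<ee = *->0 (1/suc>0 n) (1/suc>0 n)
      instance
        ee-pos = ℚ.positive 0<ee
        ee-nonNeg = ℚ.nonNegative (ℚ.<⇒≤ 0<ee)
      tee : t ℚ.* (e ℚ.* e) ≡ q⁺
      tee = begin-equality
        q⁺ ℚ.* (K ℚ.* K) ℚ.* (e ℚ.* e)       ≡⟨ solve 3 (λ q K e → q :* (K :* K) :* (e :* e) := q :* ((K :* e) :* (K :* e))) refl q⁺ K e ⟩
        q⁺ ℚ.* ((K ℚ.* e) ℚ.* (K ℚ.* e))     ≡⟨ cong (λ z → q⁺ ℚ.* (z ℚ.* z)) (1/suc-inverse n) ⟩
        q⁺ ℚ.* (1ℚ ℚ.* 1ℚ)                   ≡⟨ solve 1 (λ q → q :* (con 1ℚ :* con 1ℚ) := q) refl q⁺ ⟩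
        q⁺                                   ∎

    √ℚ-lower : √ℚ n q ℚ.* √ℚ n q ℚ.≤ q⁺
    √ℚ-lower = begin
      √ℚ n q ℚ.* √ℚ n q                     ≡⟨ cong (λ s → s ℚ.* s) (√ℚ-unfold n q) ⟩
      fromℕ k ℚ.* e ℚ.* (fromℕ k ℚ.* e)     ≡⟨ solve 2 (λ k e → k :* e :* (k :* e) := k :* k :* (e :* e)) refl (fromℕ k) e ⟩
      fromℕ k ℚ.* fromℕ k ℚ.* (e ℚ.* e)     ≡⟨ cong (ℚ._* (e ℚ.* e)) (sym (fromℕ-* k k)) ⟩
      fromℕ (k ℕ.* k) ℚ.* (e ℚ.* e)         ≤⟨ ℚ.*-monoʳ-≤-nonNeg (e ℚ.* e) (ℚ.≤-trans (fromℕ-mono-≤ (k ℕ.* k) F (⌊√⌋-lower F)) (floor-lower t 0≤t)) ⟩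
      t ℚ.* (e ℚ.* e)                       ≡⟨ tee ⟩
      q⁺                                    ∎

    √ℚ-upper : q⁺ ℚ.< (√ℚ n q ℚ.+ e) ℚ.* (√ℚ n q ℚ.+ e)
    √ℚ-upper = begin-strict
      q⁺                                                ≡⟨ sym tee ⟩
      t ℚ.* (e ℚ.* e)                                   <⟨ ℚ.*-monoˡ-<-pos (e ℚ.* e) (ℚ.<-≤-trans (floor-upper t 0≤t) (fromℕ-mono-≤ (suc F) (suc k ℕ.* suc k) (⌊√⌋-upper F))) ⟩
      fromℕ (suc k ℕ.* suc k) ℚ.* (e ℚ.* e)             ≡⟨ cong (ℚ._* (e ℚ.* e)) (trans (fromℕ-* (suc k) (suc k)) (cong (λ z → z ℚ.* z) (fromℕ-+ 1 k))) ⟩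
      (1ℚ ℚ.+ fromℕ k) ℚ.* (1ℚ ℚ.+ fromℕ k) ℚ.* (e ℚ.* e) ≡⟨ solve 2 (λ k e → (con 1ℚ :+ k) :* (con 1ℚ :+ k) :* (e :* e) := (k :* e :+ e) :* (k :* e :+ e)) refl (fromℕ k) e ⟩
      (fromℕ k ℚ.* e ℚ.+ e) ℚ.* (fromℕ k ℚ.* e ℚ.+ e)   ≡⟨ cong (λ s → (s ℚ.+ e) ℚ.* (s ℚ.+ e)) (sym (√ℚ-unfold n q)) ⟩
      (√ℚ n q ℚ.+ e) ℚ.* (√ℚ n q ℚ.+ e)                 ∎

  √ℚ-near : ∀ m n p q {d} → 0ℚ ℚ.< d → p ℚ.≤ q ℚ.+ d ℚ.* d → √ℚ m p ℚ.≤ √ℚ n q ℚ.+ 1/suc n ℚ.+ d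
  √ℚ-near m n p q {d} 0<d p≤ = ℚ.<⇒≤ (square-cancel-< (√ℚ≥0 m p) (ℚ.+-mono-≤ 0≤b 0≤d) (begin-strict
    √ℚ m p ℚ.* √ℚ m p              ≤⟨ √ℚ-lower m p ⟩
    p ℚ.⊔ 0ℚ                       ≤⟨ ℚ.⊔-lub (ℚ.≤-trans p≤ (ℚ.+-monoˡ-≤ _ (ℚ.p≤p⊔q q 0ℚ)))
                                              (ℚ.+-mono-≤ (ℚ.p≤q⊔p q 0ℚ) (square≥0 d)) ⟩
    q ℚ.⊔ 0ℚ ℚ.+ d ℚ.* d           <⟨ ℚ.+-monoˡ-< (d ℚ.* d) (√ℚ-upper n q) ⟩
    b ℚ.* b ℚ.+ d ℚ.* d            ≡⟨ sym (ℚ.+-identityʳ (b ℚ.* b ℚ.+ d ℚ.* d)) ⟩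
    b ℚ.* b ℚ.+ d ℚ.* d ℚ.+ 0ℚ     ≤⟨ ℚ.+-monoʳ-≤ (b ℚ.* b ℚ.+ d ℚ.* d) (ℚ.+-mono-≤ (*-≥0 0≤b 0≤d) (*-≥0 0≤b 0≤d)) ⟩
    b ℚ.* b ℚ.+ d ℚ.* d ℚ.+ (b ℚ.* d ℚ.+ b ℚ.* d) ≡⟨ solve 2 (λ b d → b :* b :+ d :* d :+ (b :* d :+ b :* d) := (b :+ d) :* (b :+ d)) refl b d ⟩
    (b ℚ.+ d) ℚ.* (b ℚ.+ d)        ∎))
    where
    b = √ℚ n q ℚ.+ 1/suc n
    0≤d = ℚ.<⇒≤ 0<d
    0≤b : 0ℚ ℚ.≤ b
    0≤b = ℚ.+-mono-≤ (√ℚ≥0 n q) (ℚ.<⇒≤ (1/suc>0 n))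

  √ℚ-close : ∀ m n p q {ε} → 0ℚ ℚ.< ε → ℚ.∣ p ℚ.- q ∣ ℚ.≤ ½ ℚ.* ε ℚ.* (½ ℚ.* ε) →
             1/suc m ℚ.≤ ½ ℚ.* ε → 1/suc n ℚ.≤ ½ ℚ.* ε → ℚ.∣ √ℚ m p ℚ.- √ℚ n q ∣ ℚ.≤ ε
  √ℚ-close m n p q {ε} 0<ε le em en = ∣-∣-≤ (step m n p q le en)
    (step n m q p (ℚ.≤-trans (ℚ.≤-reflexive (∣-∣-sym q p)) le) em)
    where
    step : ∀ m n p q → ℚ.∣ p ℚ.- q ∣ ℚ.≤ ½ ℚ.* ε ℚ.* (½ ℚ.* ε) →
           1/suc n ℚ.≤ ½ ℚ.* ε → √ℚ m p ℚ.≤ √ℚ n q ℚ.+ ε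
    step m n p q le en = begin
      √ℚ m p                                ≤⟨ √ℚ-near m n p q (half>0 0<ε) (∣-∣-≤⁻¹ le) ⟩
      √ℚ n q ℚ.+ 1/suc n ℚ.+ ½ ℚ.* ε        ≤⟨ ℚ.+-monoˡ-≤ (½ ℚ.* ε) (ℚ.+-monoʳ-≤ (√ℚ n q) en) ⟩
      √ℚ n q ℚ.+ ½ ℚ.* ε ℚ.+ ½ ℚ.* ε        ≡⟨ ℚ.+-assoc (√ℚ n q) (½ ℚ.* ε) (½ ℚ.* ε) ⟩
      √ℚ n q ℚ.+ (½ ℚ.* ε ℚ.+ ½ ℚ.* ε)      ≡⟨ cong (√ℚ n q ℚ.+_) (halves ε) ⟩
      √ℚ n q ℚ.+ ε                          ∎

  approx-square : ∀ {s e q B ε} → 0ℚ ℚ.≤ s → 0ℚ ℚ.≤ e →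
                  s ℚ.* s ℚ.≤ q ℚ.⊔ 0ℚ → q ℚ.⊔ 0ℚ ℚ.< (s ℚ.+ e) ℚ.* (s ℚ.+ e) →
                  0ℚ ℚ.< B → 0ℚ ℚ.< ε → ℚ.∣ s ∣ ℚ.≤ B → 0ℚ ℚ.≤ q ℚ.+ ε →
                  e ℚ.≤ 1ℚ → e ℚ.≤ ε ℚ.* inverseℚ (B ℚ.+ B ℚ.+ 1ℚ) →
                  ℚ.∣ s ℚ.* s ℚ.- q ∣ ℚ.≤ ε
  approx-square {s} {e} {q} {B} {ε} 0≤s 0≤e lower upper 0<B 0<ε s≤B -ε≤q e≤1 e≤δ = ∣-∣-≤
    (begin
      s ℚ.* s                              ≤⟨ lower ⟩
      q ℚ.⊔ 0ℚ                             ≤⟨ ℚ.⊔-lub q≤q+ε -ε≤q ⟩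
      q ℚ.+ ε                              ∎)
    (begin
      q                                    ≤⟨ ℚ.p≤p⊔q q 0ℚ ⟩
      q ℚ.⊔ 0ℚ                             ≤⟨ ℚ.<⇒≤ upper ⟩
      (s ℚ.+ e) ℚ.* (s ℚ.+ e)              ≡⟨ solve 2 (λ s e → (s :+ e) :* (s :+ e) := s :* s :+ (s :+ s :+ e) :* e) refl s e ⟩
      s ℚ.* s ℚ.+ (s ℚ.+ s ℚ.+ e) ℚ.* e    ≤⟨ ℚ.+-monoʳ-≤ (s ℚ.* s) (*-mono 0≤2s+e 0≤δ 2s+e≤C e≤δ) ⟩
      s ℚ.* s ℚ.+ C ℚ.* (ε ℚ.* inverseℚ C) ≡⟨ cong (s ℚ.* s ℚ.+_) Cδ ⟩
      s ℚ.* s ℚ.+ ε                        ∎)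
    where
    C = B ℚ.+ B ℚ.+ 1ℚ
    s≤ : s ℚ.≤ B
    s≤ = ℚ.≤-trans (p≤∣p∣ s) s≤B
    0<C : 0ℚ ℚ.< C
    0<C = ℚ.+-mono-< (ℚ.+-mono-< 0<B 0<B) (ℚ.positive⁻¹ 1ℚ)
    0≤δ : 0ℚ ℚ.≤ ε ℚ.* inverseℚ C
    0≤δ = ℚ.<⇒≤ (*->0 0<ε (inverseℚ>0 0<C))
    0≤2s+e : 0ℚ ℚ.≤ s ℚ.+ s ℚ.+ e
    0≤2s+e = ℚ.+-mono-≤ (ℚ.+-mono-≤ 0≤s 0≤s) 0≤e
    2s+e≤C : s ℚ.+ s ℚ.+ e ℚ.≤ C
    2s+e≤C = ℚ.+-mono-≤ (ℚ.+-mono-≤ s≤ s≤) e≤1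
    q≤q+ε : q ℚ.≤ q ℚ.+ ε
    q≤q+ε = subst (ℚ._≤ q ℚ.+ ε) (ℚ.+-identityʳ q) (ℚ.+-monoʳ-≤ q (ℚ.<⇒≤ 0<ε))
    Cδ : C ℚ.* (ε ℚ.* inverseℚ C) ≡ ε
    Cδ = begin-equality
      C ℚ.* (ε ℚ.* inverseℚ C)  ≡⟨ solve 3 (λ C e i → C :* (e :* i) := e :* (C :* i)) refl C ε (inverseℚ C) ⟩
      ε ℚ.* (C ℚ.* inverseℚ C)  ≡⟨ cong (ε ℚ.*_) (inverseℚ-correct 0<C) ⟩
      ε ℚ.* 1ℚ                  ≡⟨ ℚ.*-identityʳ ε ⟩
      ε                         ∎

  approx-pos : ∀ {s e q δ} → 0ℚ ℚ.≤ s → 0ℚ ℚ.≤ e → q ℚ.⊔ 0ℚ ℚ.< (s ℚ.+ e) ℚ.* (s ℚ.+ e) →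
               0ℚ ℚ.< δ → fromℕ 4 ℚ.* (δ ℚ.* δ) ℚ.≤ q → e ℚ.≤ δ → δ ℚ.≤ s
  approx-pos {s} {e} {q} {δ} 0≤s 0≤e upper 0<δ 4δ²≤q e≤δ with δ ℚ.≤? s
  ... | yes δ≤s = δ≤s
  ... | no  δ≰s = ⊥-elim (ℚ.<-irrefl refl (begin-strict
    fromℕ 4 ℚ.* (δ ℚ.* δ)                ≤⟨ ℚ.≤-trans 4δ²≤q (ℚ.p≤p⊔q q 0ℚ) ⟩
    q ℚ.⊔ 0ℚ                             <⟨ upper ⟩
    (s ℚ.+ e) ℚ.* (s ℚ.+ e)              ≤⟨ *-mono 0≤s+e 0≤2δ s+e≤2δ s+e≤2δ ⟩
    (δ ℚ.+ δ) ℚ.* (δ ℚ.+ δ)              ≡⟨ solve 1 (λ d → (d :+ d) :* (d :+ d) := con (fromℕ 4) :* (d :* d)) refl δ ⟩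
    fromℕ 4 ℚ.* (δ ℚ.* δ)                ∎))
    where
    0≤2δ : 0ℚ ℚ.≤ δ ℚ.+ δ
    0≤2δ = ℚ.+-mono-≤ (ℚ.<⇒≤ 0<δ) (ℚ.<⇒≤ 0<δ)
    s+e≤2δ : s ℚ.+ e ℚ.≤ δ ℚ.+ δ
    s+e≤2δ = ℚ.+-mono-≤ (ℚ.<⇒≤ (ℚ.≰⇒> δ≰s)) e≤δ
    0≤s+e : 0ℚ ℚ.≤ s ℚ.+ e
    0≤s+e = ℚ.+-mono-≤ 0≤s 0≤e

  min-¼-square : ∀ ε → 0ℚ ℚ.< ε → ∃[ δ ] (0ℚ ℚ.< δ × fromℕ 4 ℚ.* (δ ℚ.* δ) ℚ.≤ ε)
  min-¼-square ε 0<ε = δ , 0<δ , (begin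
    fromℕ 4 ℚ.* (δ ℚ.* δ)   ≡⟨ sym (ℚ.*-assoc (fromℕ 4) δ δ) ⟩
    fromℕ 4 ℚ.* δ ℚ.* δ     ≤⟨ ℚ.*-monoʳ-≤-nonNeg δ {{ℚ.nonNegative (ℚ.<⇒≤ 0<δ)}}
                                 (ℚ.*-monoˡ-≤-nonNeg (fromℕ 4) (ℚ.p⊓q≤q ε ¼)) ⟩
    1ℚ ℚ.* δ                ≡⟨ ℚ.*-identityˡ δ ⟩
    δ                       ≤⟨ ℚ.p⊓q≤p ε ¼ ⟩
    ε                       ∎)
    where
    ¼ = ½ ℚ.* ½
    δ = ε ℚ.⊓ ¼
    0<δ : 0ℚ ℚ.< δ
    0<δ with ℚ.⊓-sel ε ¼
    ... | inj₁ eq = subst (0ℚ ℚ.<_) (sym eq) 0<ε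
    ... | inj₂ eq = subst (0ℚ ℚ.<_) (sym eq) (ℚ.positive⁻¹ ¼)

  √ℚ-square : ∀ n q {B ε} → 0ℚ ℚ.< B → 0ℚ ℚ.< ε → ℚ.∣ √ℚ n q ∣ ℚ.≤ B → 0ℚ ℚ.≤ q ℚ.+ ε →
              1/suc n ℚ.≤ 1ℚ → 1/suc n ℚ.≤ ε ℚ.* inverseℚ (B ℚ.+ B ℚ.+ 1ℚ) →
              ℚ.∣ √ℚ n q ℚ.* √ℚ n q ℚ.- q ∣ ℚ.≤ ε
  √ℚ-square n q {B} {ε} = approx-square {√ℚ n q} {1/suc n} {q} {B} {ε}
    (√ℚ≥0 n q) (ℚ.<⇒≤ (1/suc>0 n)) (√ℚ-lower n q) (√ℚ-upper n q)

  √ℚ-pos : ∀ n q {δ} → 0ℚ ℚ.< δ → fromℕ 4 ℚ.* (δ ℚ.* δ) ℚ.≤ q → 1/suc n ℚ.≤ δ → δ ℚ.≤ √ℚ n q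
  √ℚ-pos n q {δ} = approx-pos {√ℚ n q} {1/suc n} {q} {δ}
    (√ℚ≥0 n q) (ℚ.<⇒≤ (1/suc>0 n)) (√ℚ-upper n q)

  4*1/4m : ∀ m .{{_ : ℕ.NonZero m}} .{{_ : ℕ.NonZero (4 ℕ.* m)}} →
           fromℕ 4 ℚ.* (+ 1 ℚ./ (4 ℕ.* m)) ≡ + 1 ℚ./ m
  4*1/4m (suc k) = begin-equality
    fromℕ 4 ℚ.* x                                  ≡⟨ sym (ℚ.*-identityʳ (fromℕ 4 ℚ.* x)) ⟩
    fromℕ 4 ℚ.* x ℚ.* 1ℚ                           ≡⟨ cong (fromℕ 4 ℚ.* x ℚ.*_) (sym (1/suc-inverse k)) ⟩
    fromℕ 4 ℚ.* x ℚ.* (fromℕ (suc k) ℚ.* y)        ≡⟨ solve 4 (λ f x m y → f :* x :* (m :* y) := f :* m :* x :* y) refl (fromℕ 4) x (fromℕ (suc k)) y ⟩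
    fromℕ 4 ℚ.* fromℕ (suc k) ℚ.* x ℚ.* y          ≡⟨ cong (λ z → z ℚ.* x ℚ.* y) (sym (fromℕ-* 4 (suc k))) ⟩
    fromℕ (4 ℕ.* suc k) ℚ.* x ℚ.* y                ≡⟨ cong (ℚ._* y) (1/suc-inverse (k ℕ.+ 3 ℕ.* suc k)) ⟩
    1ℚ ℚ.* y                                       ≡⟨ ℚ.*-identityˡ y ⟩
    y                                              ∎
    where
    x = 1/suc (k ℕ.+ 3 ℕ.* suc k)
    y = 1/suc k

-- Cauchy sequences of rationals. The quotient by _≃_ is not taken: the reals are
-- the setoid (ℝ, _≃_). Since the modulus of convergence carries no rate, all
-- operations act termwise.
record ℝ : Set where
  constructor mkℝ
  field
    seq    : ℕ → ℚ
    cauchy : ∀ ε → 0ℚ ℚ.< ε →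
             ∃[ N ] (∀ m n → N ℕ.≤ m → N ℕ.≤ n → ℚ.∣ seq m ℚ.- seq n ∣ ℚ.≤ ε)

open ℝ public

infix 4 _≃_ _<_ _≤_

_≃_ : ℝ → ℝ → Set
x ≃ y = ∀ ε → 0ℚ ℚ.< ε → Eventually (λ n → ℚ.∣ seq x n ℚ.- seq y n ∣ ℚ.≤ ε)

_<_ : ℝ → ℝ → Set
x < y = ∃[ ε ] (0ℚ ℚ.< ε × Eventually (λ n → seq x n ℚ.+ ε ℚ.≤ seq y n))

_≤_ : ℝ → ℝ → Set
x ≤ y = ∀ ε → 0ℚ ℚ.< ε → Eventually (λ n → seq x n ℚ.≤ seq y n ℚ.+ ε)

bounded : ∀ x → ∃[ B ] (0ℚ ℚ.< B × Eventually (λ n → ℚ.∣ seq x n ∣ ℚ.≤ B))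
bounded x with cauchy x 1ℚ (ℚ.positive⁻¹ 1ℚ)
... | N , close = ℚ.∣ c ∣ ℚ.+ 1ℚ , ℚ.+-mono-≤-< (ℚ.0≤∣p∣ c) (ℚ.positive⁻¹ 1ℚ) , N , λ n N≤n → begin
    ℚ.∣ seq x n ∣                      ≡⟨ cong ℚ.∣_∣ (solve 2 (λ a c → a := c :+ (a :- c)) refl (seq x n) c) ⟩
    ℚ.∣ c ℚ.+ (seq x n ℚ.- c) ∣        ≤⟨ ℚ.∣p+q∣≤∣p∣+∣q∣ c (seq x n ℚ.- c) ⟩
    ℚ.∣ c ∣ ℚ.+ ℚ.∣ seq x n ℚ.- c ∣    ≤⟨ ℚ.+-monoʳ-≤ ℚ.∣ c ∣ (close n N N≤n ℕ.≤-refl) ⟩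
    ℚ.∣ c ∣ ℚ.+ 1ℚ                     ∎
  where
  c = seq x N
  open ℚ.≤-Reasoning
  open +-*-Solver

infix  8 -_
infixl 7 _*_
infixl 6 _+_ _-_

fromℚ : ℚ → ℝ
fromℚ q = mkℝ (λ _ → q) λ ε 0<ε → 0 , λ _ _ _ _ →
  subst (λ z → ℚ.∣ z ∣ ℚ.≤ ε) (sym (ℚ.+-inverseʳ q)) (ℚ.<⇒≤ 0<ε)

_+_ : ℝ → ℝ → ℝ
seq (x + y) n = seq x n ℚ.+ seq y n
cauchy (x + y) ε 0<ε with cauchy x (½ ℚ.* ε) (half>0 0<ε) | cauchy y (½ ℚ.* ε) (half>0 0<ε)
... | M , closeˣ | N , closeʸ = M ℕ.⊔ N , λ m n ≤m ≤n → begin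
    ℚ.∣ (seq x m ℚ.+ seq y m) ℚ.- (seq x n ℚ.+ seq y n) ∣
      ≡⟨ cong ℚ.∣_∣ (solve 4 (λ a b c d → (a :+ b) :- (c :+ d) := (a :- c) :+ (b :- d)) refl
           (seq x m) (seq y m) (seq x n) (seq y n)) ⟩
    ℚ.∣ (seq x m ℚ.- seq x n) ℚ.+ (seq y m ℚ.- seq y n) ∣
      ≤⟨ ℚ.∣p+q∣≤∣p∣+∣q∣ (seq x m ℚ.- seq x n) (seq y m ℚ.- seq y n) ⟩
    ℚ.∣ seq x m ℚ.- seq x n ∣ ℚ.+ ℚ.∣ seq y m ℚ.- seq y n ∣
      ≤⟨ ℚ.+-mono-≤ (closeˣ m n (ℕ.m⊔n≤o⇒m≤o M N ≤m) (ℕ.m⊔n≤o⇒m≤o M N ≤n))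
                    (closeʸ m n (ℕ.m⊔n≤o⇒n≤o M N ≤m) (ℕ.m⊔n≤o⇒n≤o M N ≤n)) ⟩
    ½ ℚ.* ε ℚ.+ ½ ℚ.* ε
      ≡⟨ halves ε ⟩
    ε ∎
  where
  open ℚ.≤-Reasoning
  open +-*-Solver

-_ : ℝ → ℝ
seq (- x) n = ℚ.- seq x n
cauchy (- x) ε 0<ε with cauchy x ε 0<ε
... | N , close = N , λ m n ≤m ≤n → subst (ℚ._≤ ε)
    (trans (∣-∣-sym (seq x m) (seq x n))
      (cong ℚ.∣_∣ (solve 2 (λ a b → b :- a := :- a :- (:- b)) refl (seq x m) (seq x n))))
    (close m n ≤m ≤n)
  where open +-*-Solver

_-_ : ℝ → ℝ → ℝ
x - y = x + (- y)

_*_ : ℝ → ℝ → ℝ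
seq (x * y) n = seq x n ℚ.* seq y n
cauchy (x * y) ε 0<ε = (K ℕ.⊔ L) ℕ.⊔ (M ℕ.⊔ N) , λ m n ≤m ≤n → *-close 0<A 0<B 0<ε
    (x≤A m (left K L (left K⊔L M⊔N ≤m))) (y≤B n (right K L (left K⊔L M⊔N ≤n)))
    (closeˣ m n (left M N (right K⊔L M⊔N ≤m)) (left M N (right K⊔L M⊔N ≤n)))
    (closeʸ m n (right M N (right K⊔L M⊔N ≤m)) (right M N (right K⊔L M⊔N ≤n)))
  where
  left = ℕ.m⊔n≤o⇒m≤o
  right = ℕ.m⊔n≤o⇒n≤o
  A   = proj₁ (bounded x)
  0<A = proj₁ (proj₂ (bounded x))
  K   = proj₁ (proj₂ (proj₂ (bounded x)))
  x≤A = proj₂ (proj₂ (proj₂ (bounded x)))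
  B   = proj₁ (bounded y)
  0<B = proj₁ (proj₂ (bounded y))
  L   = proj₁ (proj₂ (proj₂ (bounded y)))
  y≤B = proj₂ (proj₂ (proj₂ (bounded y)))
  δ   = ε ℚ.* inverseℚ (A ℚ.+ B)
  0<δ = *->0 0<ε (inverseℚ>0 (ℚ.+-mono-< 0<A 0<B))
  M      = proj₁ (cauchy x δ 0<δ)
  closeˣ = proj₂ (cauchy x δ 0<δ)
  N      = proj₁ (cauchy y δ 0<δ)
  closeʸ = proj₂ (cauchy y δ 0<δ)
  K⊔L = K ℕ.⊔ L
  M⊔N = M ℕ.⊔ N

∣_∣ : ℝ → ℝ
seq ∣ x ∣ n = ℚ.∣ seq x n ∣
cauchy ∣ x ∣ ε 0<ε with cauchy x ε 0<ε
... | N , close = N , λ m n ≤m ≤n → ∣-∣-≤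
    (∣∣≤∣∣+ (seq x m) (seq x n) (close m n ≤m ≤n)) (∣∣≤∣∣+ (seq x n) (seq x m) (close n m ≤n ≤m))
  where
  open ℚ.≤-Reasoning
  open +-*-Solver
  ∣∣≤∣∣+ : ∀ p q → ℚ.∣ p ℚ.- q ∣ ℚ.≤ ε → ℚ.∣ p ∣ ℚ.≤ ℚ.∣ q ∣ ℚ.+ ε
  ∣∣≤∣∣+ p q le = begin
    ℚ.∣ p ∣                        ≡⟨ cong ℚ.∣_∣ (solve 2 (λ p q → p := q :+ (p :- q)) refl p q) ⟩
    ℚ.∣ q ℚ.+ (p ℚ.- q) ∣          ≤⟨ ℚ.∣p+q∣≤∣p∣+∣q∣ q (p ℚ.- q) ⟩
    ℚ.∣ q ∣ ℚ.+ ℚ.∣ p ℚ.- q ∣      ≤⟨ ℚ.+-monoʳ-≤ ℚ.∣ q ∣ le ⟩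
    ℚ.∣ q ∣ ℚ.+ ε                  ∎

0ℝ 1ℝ ½ℝ : ℝ
0ℝ = fromℚ 0ℚ
1ℝ = fromℚ 1ℚ
½ℝ = fromℚ ½

inverse : ∀ x → 0ℝ < x → ℝ
seq (inverse x _) n = inverseℚ (seq x n)
cauchy (inverse x (δ , 0<δ , K , x≥δ)) ε 0<ε with cauchy x (ε ℚ.* (δ ℚ.* δ)) (*->0 0<ε (*->0 0<δ 0<δ))
... | N , close = K ℕ.⊔ N , λ m n ≤m ≤n → inverseℚ-close 0<δ (ℚ.<⇒≤ 0<ε)
    (δ≤ m (ℕ.m⊔n≤o⇒m≤o K N ≤m)) (δ≤ n (ℕ.m⊔n≤o⇒m≤o K N ≤n))
    (close m n (ℕ.m⊔n≤o⇒n≤o K N ≤m) (ℕ.m⊔n≤o⇒n≤o K N ≤n))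
  where
  δ≤ : ∀ n → K ℕ.≤ n → δ ℚ.≤ seq x n
  δ≤ n K≤n = subst (ℚ._≤ seq x n) (ℚ.+-identityˡ δ) (x≥δ n K≤n)

-- The square root of max(x,0).
√ : ℝ → ℝ
seq (√ x) n = √ℚ n (seq x n)
cauchy (√ x) ε 0<ε = M ℕ.⊔ N , λ m n ≤m ≤n → √ℚ-close m n (seq x m) (seq x n) 0<ε
    (close m n (left M N ≤m) (left M N ≤n)) (small m (right M N ≤m)) (small n (right M N ≤n))
  where
  left = ℕ.m⊔n≤o⇒m≤o
  right = ℕ.m⊔n≤o⇒n≤o
  d = ½ ℚ.* ε
  0<d = half>0 0<ε
  M     = proj₁ (cauchy x (d ℚ.* d) (*->0 0<d 0<d))
  close = proj₂ (cauchy x (d ℚ.* d) (*->0 0<d 0<d))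
  N     = proj₁ (1/suc-small 0<d)
  small = proj₂ (1/suc-small 0<d)

inverse-correct : ∀ x (0<x : 0ℝ < x) → x * inverse x 0<x ≃ 1ℝ
inverse-correct x (δ , 0<δ , N , x≥δ) ε 0<ε = N , λ n N≤n →
  subst (λ z → ℚ.∣ z ℚ.- 1ℚ ∣ ℚ.≤ ε)
    (sym (inverseℚ-correct (ℚ.<-≤-trans 0<δ (subst (ℚ._≤ seq x n) (ℚ.+-identityˡ δ) (x≥δ n N≤n)))))
    (ℚ.<⇒≤ 0<ε)

√-nonneg : ∀ x → 0ℝ ≤ √ x
√-nonneg x ε 0<ε = 0 , λ n _ → ℚ.+-mono-≤ (√ℚ≥0 n (seq x n)) (ℚ.<⇒≤ 0<ε)

√-square : ∀ x → 0ℝ ≤ x → √ x * √ x ≃ x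
√-square x 0≤x ε 0<ε = (K ℕ.⊔ L) ℕ.⊔ (M ℕ.⊔ N) , λ n ≤n →
    √ℚ-square n (seq x n) {B} {ε} 0<B 0<ε
      (s≤B n (left K L (left K⊔L M⊔N ≤n))) (-ε≤x n (right K L (left K⊔L M⊔N ≤n)))
      (e≤1 n (left M N (right K⊔L M⊔N ≤n))) (e≤δ n (right M N (right K⊔L M⊔N ≤n)))
  where
  left = ℕ.m⊔n≤o⇒m≤o
  right = ℕ.m⊔n≤o⇒n≤o
  B   = proj₁ (bounded (√ x))
  0<B = proj₁ (proj₂ (bounded (√ x)))
  K   = proj₁ (proj₂ (proj₂ (bounded (√ x))))
  s≤B = proj₂ (proj₂ (proj₂ (bounded (√ x))))
  L    = proj₁ (0≤x ε 0<ε)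
  -ε≤x = proj₂ (0≤x ε 0<ε)
  0<1 : 0ℚ ℚ.< 1ℚ
  0<1 = ℚ.positive⁻¹ 1ℚ
  δ = ε ℚ.* inverseℚ (B ℚ.+ B ℚ.+ 1ℚ)
  0<δ : 0ℚ ℚ.< δ
  0<δ = *->0 0<ε (inverseℚ>0 (ℚ.+-mono-< (ℚ.+-mono-< 0<B 0<B) 0<1))
  M   = proj₁ (1/suc-small 0<1)
  e≤1 = proj₂ (1/suc-small 0<1)
  N   = proj₁ (1/suc-small 0<δ)
  e≤δ = proj₂ (1/suc-small 0<δ)
  K⊔L = K ℕ.⊔ L
  M⊔N = M ℕ.⊔ N

√-pos : ∀ x → 0ℝ < x → 0ℝ < √ x
√-pos x (ε , 0<ε , K , x≥ε) = δ , 0<δ , K ℕ.⊔ N , λ n ≤n →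
    subst (ℚ._≤ √ℚ n (seq x n)) (sym (ℚ.+-identityˡ δ))
      (√ℚ-pos n (seq x n) {δ} 0<δ
        (ℚ.≤-trans 4δ²≤ε (subst (ℚ._≤ seq x n) (ℚ.+-identityˡ ε) (x≥ε n (ℕ.m⊔n≤o⇒m≤o K N ≤n))))
        (e≤δ n (ℕ.m⊔n≤o⇒n≤o K N ≤n)))
  where
  δ     = proj₁ (min-¼-square ε 0<ε)
  0<δ   = proj₁ (proj₂ (min-¼-square ε 0<ε))
  4δ²≤ε = proj₂ (proj₂ (min-¼-square ε 0<ε))
  N     = proj₁ (1/suc-small 0<δ)
  e≤δ   = proj₂ (1/suc-small 0<δ)

infixl 7 _/_⟨_⟩

_/_⟨_⟩ : (x y : ℝ) → 0ℝ < y → ℝ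
x / y ⟨ 0<y ⟩ = x * inverse y 0<y

∏[k<_] : ℕ → (ℕ → ℝ) → ℝ
∏[k< zero  ] f = 1ℝ
∏[k< suc n ] f = ∏[k< n ] f * f n

4ℝ : ℝ
4ℝ = fromℚ (fromℕ 4)

disc : ℝ → ℝ → ℝ
disc r v = (1ℝ - v) * (1ℝ - v) + 4ℝ * r

disc-pos : ∀ r v → 0ℝ < r → 0ℝ < disc r v
disc-pos r v (ε , 0<ε , N , r≥ε) = ε , 0<ε , N , λ n N≤n →
  ℚ.+-mono-≤ (square≥0 (1ℚ ℚ.- seq v n)) (begin
    ε                       ≡⟨ sym (ℚ.*-identityˡ ε) ⟩
    1ℚ ℚ.* ε                ≤⟨ *-mono (ℚ.nonNegative⁻¹ 1ℚ)
                                 (ℚ.≤-trans (ℚ.<⇒≤ 0<ε) (ε≤r n N≤n)) (fromℕ-mono-≤ 1 4 (ℕ.s≤s ℕ.z≤n)) (ε≤r n N≤n) ⟩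
    fromℕ 4 ℚ.* seq r n     ∎)
  where
  open ℚ.≤-Reasoning
  ε≤r : ∀ n → N ℕ.≤ n → ε ℚ.≤ seq r n
  ε≤r n N≤n = subst (ℚ._≤ seq r n) (ℚ.+-identityˡ ε) (r≥ε n N≤n)

Ψ : ℝ → ℝ → ℝ
Ψ r v = ½ℝ * (1ℝ + v - √ (disc r v))

-- The derivative of Ψ r at v: since d/dv √(disc r v) = - (1 - v) / √(disc r v),
-- it is ½ (1 + (1 - v) / √(disc r v)).
∂Ψ : ∀ r → 0ℝ < r → ℝ → ℝ
∂Ψ r 0<r v = ½ℝ * (1ℝ + (1ℝ - v) / √ (disc r v) ⟨ √-pos (disc r v) (disc-pos r v 0<r) ⟩)

module _ (m : ℕ) .{{_ : NonTrivial m}} where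
  private instance
    m≢0 = ℕ.nonTrivial⇒nonZero m
    4m≢0 = ℕ.m*n≢0 4 m

  r : ℝ
  r = fromℚ (+ 1 ℚ./ (4 ℕ.* m))

  r-pos : 0ℝ < r
  r-pos = q , ℚ.positive⁻¹ q {{ℚ.normalize-pos 1 (4 ℕ.* m)}} , 0 , λ _ _ → ℚ.≤-reflexive (ℚ.+-identityˡ q)
    where q = + 1 ℚ./ (4 ℕ.* m)

  4r≃1/m : 4ℝ * r ≃ fromℚ (+ 1 ℚ./ m)
  4r≃1/m ε 0<ε = 0 , λ _ _ → subst (λ z → ℚ.∣ z ∣ ℚ.≤ ε) (sym eq) (ℚ.<⇒≤ 0<ε)
    where
    eq : fromℕ 4 ℚ.* (+ 1 ℚ./ (4 ℕ.* m)) ℚ.- (+ 1 ℚ./ m) ≡ 0ℚ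
    eq = trans (cong (ℚ._- (+ 1 ℚ./ m)) (4*1/4m m)) (ℚ.+-inverseʳ (+ 1 ℚ./ m))

  w : ℕ → ℝ
  w zero    = ½ℝ
  w (suc k) = Ψ r (w k)

  -- The factors are those with 0 ≤ k ≤ m - 2.
  p⊤ : ℝ
  p⊤ = ∏[k< m ℕ.∸ 1 ] (λ k → ∂Ψ r r-pos (w k))

3ℝ : ℝ
3ℝ = fromℚ (fromℕ 3)

1/√3 : ℝ
1/√3 = inverse (√ 3ℝ) (√-pos 3ℝ (fromℕ 3 , ℚ.positive⁻¹ (fromℕ 3) , 0 , λ _ _ → ℚ.≤-refl))

{-# OPTIONS --safe #-}

-- Put x_k = 1 - w_k, s_k = √(x_k² + 4r), so that x_{k+1} = (x_k + s_k)/2 and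
-- ∂Ψ(w_k) = x_{k+1}/s_k, and let d = x_{k+1} - x_k. Then d x_{k+1} = r, hence
-- 0 ≤ d ≤ 2r and x_{k+1}² + d² = x_k² + 2r: x_k² is 1/4 + 2kr up to 4kr².
-- With P_k the product of the first k factors,
-- P_{k+1} x_{k+1} = P_k x_k + P_k d²/s_k, so P_k x_k is almost constant, equal to 1/2
-- up to 16kr² P_k x_k. For k = m - 1 and 4r = 1/m this gives x_k² = 3/4 + O(1/m)
-- and 1/3 ≤ P_k² ≤ 1/3 + 6/m.
module Submission where

open import Defs
open import Data.Empty using (⊥-elim)
open import Data.Fin.Patterns
open import Data.Nat.Base as ℕ using (ℕ; zero; suc; NonTrivial)
import Data.Nat.Properties as ℕ
open import Data.Product.Base using (∃-syntax; _,_; proj₁; proj₂)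
open import Data.Rational.Base as ℚ using (ℚ; 0ℚ; 1ℚ; ½)
import Data.Rational.Properties as ℚ
open import Data.Rational.Solver using (module +-*-Solver)
open import Data.Sum.Base using (inj₁; inj₂)
open import Data.Vec.Base as Vec using (Vec; []; _∷_; lookup)
import Data.Vec.Properties as Vec
open import Relation.Binary.PropositionalEquality
  using (_≡_; refl; sym; trans; cong; cong₂; subst)
open import Relation.Nullary.Decidable using (yes; no; from-yes)
open +-*-Solver

-- Order and multiplication on Cauchy reals.

eventually₂ : ∀ {P Q R : ℕ → Set} → (∀ n → P n → Q n → R n) →
              Eventually P → Eventually Q → Eventually R
eventually₂ f (M , p) (N , q) = M ℕ.⊔ N , λ n ≤n →
  f n (p n (ℕ.m⊔n≤o⇒m≤o M N ≤n)) (q n (ℕ.m⊔n≤o⇒n≤o M N ≤n))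

⊓->0 : ∀ {p q} → 0ℚ ℚ.< p → 0ℚ ℚ.< q → 0ℚ ℚ.< p ℚ.⊓ q
⊓->0 {p} {q} 0<p 0<q with ℚ.⊓-sel p q
... | inj₁ eq = subst (0ℚ ℚ.<_) (sym eq) 0<p
... | inj₂ eq = subst (0ℚ ℚ.<_) (sym eq) 0<q

pointwise-≤ : ∀ {x y} → (∀ n → seq x n ℚ.≤ seq y n) → x ≤ y
pointwise-≤ {x} {y} x≤y ε 0<ε = 0 , λ n _ → begin
  seq x n           ≡⟨ sym (ℚ.+-identityʳ (seq x n)) ⟩
  seq x n ℚ.+ 0ℚ    ≤⟨ ℚ.+-mono-≤ (x≤y n) (ℚ.<⇒≤ 0<ε) ⟩
  seq y n ℚ.+ ε     ∎
  where open ℚ.≤-Reasoning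

fromℚ-mono-≤ : ∀ {p q} → p ℚ.≤ q → fromℚ p ≤ fromℚ q
fromℚ-mono-≤ {p} {q} p≤q = pointwise-≤ {fromℚ p} {fromℚ q} λ _ → p≤q

≤-trans : ∀ {x y z} → x ≤ y → y ≤ z → x ≤ z
≤-trans {x} {y} {z} x≤y y≤z ε 0<ε = eventually₂
  (λ n x≤ y≤ → begin
    seq x n                              ≤⟨ x≤ ⟩
    seq y n ℚ.+ ½ ℚ.* ε                  ≤⟨ ℚ.+-monoˡ-≤ (½ ℚ.* ε) y≤ ⟩
    seq z n ℚ.+ ½ ℚ.* ε ℚ.+ ½ ℚ.* ε      ≡⟨ solve 2 (λ z e → z :+ con ½ :* e :+ con ½ :* e := z :+ e) refl (seq z n) ε ⟩
    seq z n ℚ.+ ε                        ∎)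
  (x≤y (½ ℚ.* ε) (half>0 0<ε)) (y≤z (½ ℚ.* ε) (half>0 0<ε))
  where open ℚ.≤-Reasoning

+-mono-≤ : ∀ {x y u v} → x ≤ y → u ≤ v → x + u ≤ y + v
+-mono-≤ {x} {y} {u} {v} x≤y u≤v ε 0<ε = eventually₂
  (λ n x≤ u≤ → begin
    seq x n ℚ.+ seq u n                                      ≤⟨ ℚ.+-mono-≤ x≤ u≤ ⟩
    (seq y n ℚ.+ ½ ℚ.* ε) ℚ.+ (seq v n ℚ.+ ½ ℚ.* ε)          ≡⟨ solve 3 (λ y v e → (y :+ con ½ :* e) :+ (v :+ con ½ :* e) := y :+ v :+ e) refl (seq y n) (seq v n) ε ⟩
    seq y n ℚ.+ seq v n ℚ.+ ε                                ∎)
  (x≤y (½ ℚ.* ε) (half>0 0<ε)) (u≤v (½ ℚ.* ε) (half>0 0<ε))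
  where open ℚ.≤-Reasoning

≃⇒≤ : ∀ {x y} → x ≃ y → x ≤ y
≃⇒≤ x≃y ε 0<ε with x≃y ε 0<ε
... | N , close = N , λ n N≤n → ∣-∣-≤⁻¹ (close n N≤n)

≃-sym : ∀ {x y} → x ≃ y → y ≃ x
≃-sym {x} {y} x≃y ε 0<ε with x≃y ε 0<ε
... | N , close = N , λ n N≤n → subst (ℚ._≤ ε) (∣-∣-sym (seq x n) (seq y n)) (close n N≤n)

≃⇒≥ : ∀ {x y} → x ≃ y → y ≤ x
≃⇒≥ {x} {y} x≃y = ≃⇒≤ {y} {x} (≃-sym {x} {y} x≃y)

-- Ring operations on ℝ act termwise, so an identity that reduces a relation to a
-- linear combination of known ones is left to the solver for ℚ.
≤-via : ∀ {a b x y} → x ≤ y → (∀ n → seq a n ℚ.- seq b n ≡ seq x n ℚ.- seq y n) → a ≤ b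
≤-via {a} {b} {x} {y} x≤y eq ε 0<ε with x≤y ε 0<ε
... | N , close = N , λ n N≤n → -≤⇒≤+ (subst (ℚ._≤ ε) (sym (eq n)) (≤+⇒-≤ (close n N≤n)))

≃-via : ∀ {a b x y} → x ≃ y → (∀ n → seq a n ℚ.- seq b n ≡ seq x n ℚ.- seq y n) → a ≃ b
≃-via {a} {b} {x} {y} x≃y eq ε 0<ε with x≃y ε 0<ε
... | N , close = N , λ n N≤n → subst (λ z → ℚ.∣ z ∣ ℚ.≤ ε) (sym (eq n)) (close n N≤n)

-- The hypotheses only make the shifted terms `a + η` and `b + η` nonnegative. Their product exceeds
-- `a * b` by `η * (a + b + η)`, which is at most `ε` once `η` is at most 1 and at most `ε` divided
-- by `C`, the sum of the two bounds and 1.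
*-nonneg : ∀ {x y} → 0ℝ ≤ x → 0ℝ ≤ y → 0ℝ ≤ x * y
*-nonneg {x} {y} 0≤x 0≤y ε 0<ε = eventually₂
  (λ { n (0≤a+η , 0≤b+η) (∣a∣≤A , ∣b∣≤B) → let a = seq x n; b = seq y n in begin
    0ℚ                                                ≤⟨ *-≥0 0≤a+η 0≤b+η ⟩
    (a ℚ.+ η) ℚ.* (b ℚ.+ η)                           ≡⟨ solve 3 (λ a b e → (a :+ e) :* (b :+ e) := a :* b :+ e :* (a :+ b :+ e)) refl a b η ⟩
    a ℚ.* b ℚ.+ η ℚ.* (a ℚ.+ b ℚ.+ η)                 ≤⟨ ℚ.+-monoʳ-≤ (a ℚ.* b) (ℚ.*-monoˡ-≤-nonNeg η {{ℚ.nonNegative (ℚ.<⇒≤ 0<η)}}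
                                                           (ℚ.+-mono-≤ (ℚ.+-mono-≤ (ℚ.≤-trans (p≤∣p∣ a) ∣a∣≤A) (ℚ.≤-trans (p≤∣p∣ b) ∣b∣≤B)) (ℚ.p⊓q≤q δ 1ℚ))) ⟩
    a ℚ.* b ℚ.+ η ℚ.* C                               ≤⟨ ℚ.+-monoʳ-≤ (a ℚ.* b) (ℚ.*-monoʳ-≤-nonNeg C {{ℚ.nonNegative (ℚ.<⇒≤ 0<C)}} (ℚ.p⊓q≤p δ 1ℚ)) ⟩
    a ℚ.* b ℚ.+ ε ℚ.* inverseℚ C ℚ.* C                ≡⟨ solve 4 (λ ab e i c → ab :+ e :* i :* c := ab :+ e :* (c :* i)) refl (a ℚ.* b) ε (inverseℚ C) C ⟩
    a ℚ.* b ℚ.+ ε ℚ.* (C ℚ.* inverseℚ C)              ≡⟨ cong (λ z → a ℚ.* b ℚ.+ ε ℚ.* z) (inverseℚ-correct 0<C) ⟩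
    a ℚ.* b ℚ.+ ε ℚ.* 1ℚ                              ≡⟨ cong (a ℚ.* b ℚ.+_) (ℚ.*-identityʳ ε) ⟩
    a ℚ.* b ℚ.+ ε                                     ∎ })
  (eventually₂ (λ _ → _,_) (0≤x η 0<η) (0≤y η 0<η))
  (eventually₂ (λ _ → _,_) (proj₂ (proj₂ (bounded x))) (proj₂ (proj₂ (bounded y))))
  where
  open ℚ.≤-Reasoning
  C = proj₁ (bounded x) ℚ.+ proj₁ (bounded y) ℚ.+ 1ℚ
  0<C : 0ℚ ℚ.< C
  0<C = ℚ.+-mono-< (ℚ.+-mono-< (proj₁ (proj₂ (bounded x))) (proj₁ (proj₂ (bounded y)))) (ℚ.positive⁻¹ 1ℚ)
  δ = ε ℚ.* inverseℚ C
  η = δ ℚ.⊓ 1ℚ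
  0<η : 0ℚ ℚ.< η
  0<η = ⊓->0 (*->0 0<ε (inverseℚ>0 0<C)) (ℚ.positive⁻¹ 1ℚ)

*-monoˡ-≤ : ∀ c {x y} → 0ℝ ≤ c → x ≤ y → c * x ≤ c * y
*-monoˡ-≤ c {x} {y} 0≤c x≤y = ≤-via {c * x} {c * y} {0ℝ} {c * (y - x)}
  (*-nonneg {c} {y - x} 0≤c (≤-via {0ℝ} {y - x} {x} {y} x≤y λ n →
    solve 2 (λ x y → con 0ℚ :- (y :- x) := x :- y) refl (seq x n) (seq y n)))
  λ n → solve 3 (λ c x y → c :* x :- c :* y := con 0ℚ :- c :* (y :- x)) refl (seq c n) (seq x n) (seq y n)

*-mono-≤ : ∀ {x y u v} → 0ℝ ≤ x → 0ℝ ≤ v → x ≤ y → u ≤ v → x * u ≤ y * v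
*-mono-≤ {x} {y} {u} {v} 0≤x 0≤v x≤y u≤v = ≤-trans {x * u} {x * v} {y * v}
  (*-monoˡ-≤ x {u} {v} 0≤x u≤v)
  (≤-via {x * v} {y * v} {v * x} {v * y} (*-monoˡ-≤ v {x} {y} 0≤v x≤y) λ n →
    solve 3 (λ v x y → x :* v :- y :* v := v :* x :- v :* y) refl (seq v n) (seq x n) (seq y n))

*-congˡ : ∀ c {x y} → x ≃ y → c * x ≃ c * y
*-congˡ c {x} {y} x≃y ε 0<ε = eventually₂
  (λ n c≤B x-y≤δ → let a = seq c n; u = seq x n; v = seq y n in begin
    ℚ.∣ a ℚ.* u ℚ.- a ℚ.* v ∣          ≡⟨ cong ℚ.∣_∣ (solve 3 (λ a u v → a :* u :- a :* v := a :* (u :- v)) refl a u v) ⟩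
    ℚ.∣ a ℚ.* (u ℚ.- v) ∣              ≡⟨ ℚ.∣p*q∣≡∣p∣*∣q∣ a (u ℚ.- v) ⟩
    ℚ.∣ a ∣ ℚ.* ℚ.∣ u ℚ.- v ∣          ≤⟨ *-mono (ℚ.0≤∣p∣ a) (ℚ.<⇒≤ 0<δ) c≤B x-y≤δ ⟩
    B ℚ.* (ε ℚ.* inverseℚ B)           ≡⟨ solve 3 (λ b e i → b :* (e :* i) := e :* (b :* i)) refl B ε (inverseℚ B) ⟩
    ε ℚ.* (B ℚ.* inverseℚ B)           ≡⟨ cong (ε ℚ.*_) (inverseℚ-correct 0<B) ⟩
    ε ℚ.* 1ℚ                           ≡⟨ ℚ.*-identityʳ ε ⟩
    ε                                  ∎)
  (proj₂ (proj₂ (bounded c))) (x≃y δ 0<δ)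
  where
  open ℚ.≤-Reasoning
  B = proj₁ (bounded c)
  0<B = proj₁ (proj₂ (bounded c))
  δ = ε ℚ.* inverseℚ B
  0<δ : 0ℚ ℚ.< δ
  0<δ = *->0 0<ε (inverseℚ>0 0<B)

square-cancel-≤ : ∀ {x y} → 0ℝ ≤ y → x * x ≤ y * y → x ≤ y
square-cancel-≤ {x} {y} 0≤y x²≤y² ε 0<ε = eventually₂ cancel (0≤y η 0<η) (x²≤y² (η ℚ.* ε) (*->0 0<η 0<ε))
  where
  open ℚ.≤-Reasoning
  -- With `η = ε/4` one has `(b + ε)² - ηε = b² + 2ε(b + η) + ηε`, which exceeds `b²` because
  -- `b + η` is nonnegative. So `a > b + ε` contradicts `a² ≤ b² + ηε`.
  η = ½ ℚ.* (½ ℚ.* ε)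
  0<η : 0ℚ ℚ.< η
  0<η = half>0 (half>0 0<ε)
  cancel : ∀ n → 0ℚ ℚ.≤ seq y n ℚ.+ η → seq x n ℚ.* seq x n ℚ.≤ seq y n ℚ.* seq y n ℚ.+ η ℚ.* ε →
           seq x n ℚ.≤ seq y n ℚ.+ ε
  cancel n 0≤b+η a²≤ with seq x n ℚ.≤? seq y n ℚ.+ ε
  ... | yes a≤b+ε = a≤b+ε
  ... | no  a≰b+ε = ⊥-elim (ℚ.<-irrefl refl (begin-strict
    b ℚ.* b                                                    ≡⟨ solve 1 (λ b → b :* b := b :* b :+ con 0ℚ) refl b ⟩
    b ℚ.* b ℚ.+ 0ℚ                                             <⟨ ℚ.+-monoʳ-< (b ℚ.* b) (ℚ.+-mono-≤-< (*-≥0 0≤2ε 0≤b+η) (*->0 0<η 0<ε)) ⟩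
    b ℚ.* b ℚ.+ ((ε ℚ.+ ε) ℚ.* (b ℚ.+ η) ℚ.+ η ℚ.* ε)          ≡⟨ solve 2 (λ b e → b :* b :+ ((e :+ e) :* (b :+ con ½ :* (con ½ :* e)) :+ con ½ :* (con ½ :* e) :* e)
                                                                      := (b :+ e) :* (b :+ e) :- con ½ :* (con ½ :* e) :* e) refl b ε ⟩
    (b ℚ.+ ε) ℚ.* (b ℚ.+ ε) ℚ.- η ℚ.* ε                        ≤⟨ ℚ.+-monoˡ-≤ (ℚ.- (η ℚ.* ε)) (*-mono 0≤b+ε (ℚ.≤-trans 0≤b+ε b+ε≤a) b+ε≤a b+ε≤a) ⟩
    a ℚ.* a ℚ.- η ℚ.* ε                                        ≤⟨ ≤+⇒-≤ (ℚ.≤-trans a²≤ (ℚ.≤-reflexive (ℚ.+-comm (b ℚ.* b) (η ℚ.* ε)))) ⟩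
    b ℚ.* b                                                    ∎))
    where
    a = seq x n
    b = seq y n
    0≤ε = ℚ.<⇒≤ 0<ε
    0≤2ε : 0ℚ ℚ.≤ ε ℚ.+ ε
    0≤2ε = ℚ.+-mono-≤ 0≤ε 0≤ε
    b+ε≤a : b ℚ.+ ε ℚ.≤ a
    b+ε≤a = ℚ.<⇒≤ (ℚ.≰⇒> a≰b+ε)
    0≤b+ε : 0ℚ ℚ.≤ b ℚ.+ ε
    0≤b+ε = begin
      0ℚ                                     ≤⟨ ℚ.+-mono-≤ 0≤b+η (ℚ.+-mono-≤ (ℚ.<⇒≤ (half>0 0<ε)) (ℚ.<⇒≤ 0<η)) ⟩
      (b ℚ.+ η) ℚ.+ (½ ℚ.* ε ℚ.+ η)          ≡⟨ solve 2 (λ b e → (b :+ con ½ :* (con ½ :* e)) :+ (con ½ :* e :+ con ½ :* (con ½ :* e)) := b :+ e) refl b ε ⟩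
      b ℚ.+ ε                                ∎

inverse-nonneg : ∀ x (0<x : 0ℝ < x) → 0ℝ ≤ inverse x 0<x
inverse-nonneg x 0<x@(δ , 0<δ , N , x≥δ) ε 0<ε = N , λ n N≤n → ℚ.+-mono-≤
  (ℚ.<⇒≤ (inverseℚ>0 (ℚ.<-≤-trans 0<δ (subst (ℚ._≤ seq x n) (ℚ.+-identityˡ δ) (x≥δ n N≤n)))))
  (ℚ.<⇒≤ 0<ε)

<⇒≤ : ∀ {x y} → x < y → x ≤ y
<⇒≤ {x} {y} (δ , 0<δ , N , x+δ≤y) ε 0<ε = N , λ n N≤n → begin
  seq x n            ≡⟨ sym (ℚ.+-identityʳ (seq x n)) ⟩
  seq x n ℚ.+ 0ℚ     ≤⟨ ℚ.+-monoʳ-≤ (seq x n) (ℚ.<⇒≤ 0<δ) ⟩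
  seq x n ℚ.+ δ      ≤⟨ x+δ≤y n N≤n ⟩
  seq y n            ≡⟨ sym (ℚ.+-identityʳ (seq y n)) ⟩
  seq y n ℚ.+ 0ℚ     ≤⟨ ℚ.+-monoʳ-≤ (seq y n) (ℚ.<⇒≤ 0<ε) ⟩
  seq y n ℚ.+ ε      ∎
  where open ℚ.≤-Reasoning

-- Reflected polynomial inequalities.

-- Inequalities between polynomial expressions in fixed reals ρ. Unification and the
-- ring solver work on the expressions and never unfold Cauchy sequences.
eval : ∀ {k} → Vec ℝ k → Polynomial k → ℝ
eval ρ (op [+] p q)  = eval ρ p + eval ρ q
eval ρ (op [*] p q)  = eval ρ p * eval ρ q
eval ρ (con c)       = fromℚ c
eval ρ (var i)       = lookup ρ i
eval ρ (p :^ zero)   = 1ℝ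
eval ρ (p :^ suc k)  = eval ρ p * eval ρ (p :^ k)
eval ρ (:- p)        = - eval ρ p

seq-eval : ∀ {k} (ρ : Vec ℝ k) p n → seq (eval ρ p) n ≡ ⟦ p ⟧ (Vec.map (λ x → seq x n) ρ)
seq-eval ρ (op [+] p q) n = cong₂ ℚ._+_ (seq-eval ρ p n) (seq-eval ρ q n)
seq-eval ρ (op [*] p q) n = cong₂ ℚ._*_ (seq-eval ρ p n) (seq-eval ρ q n)
seq-eval ρ (con c)      n = refl
seq-eval ρ (var i)      n = sym (Vec.lookup-map i (λ x → seq x n) ρ)
seq-eval ρ (p :^ zero)  n = refl
seq-eval ρ (p :^ suc k) n = cong₂ ℚ._*_ (seq-eval ρ p n) (seq-eval ρ (p :^ k) n)
seq-eval ρ (:- p)       n = cong ℚ.-_ (seq-eval ρ p n)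

module Inequalities {k} (ρ : Vec ℝ k) where

  infix  4 _≼_ _≋_
  infixl 6 _⊞_
  infixl 7 _⊡_

  -- A record, so that unification can read `p` and `q` off the type; `eval ρ p ≤ eval ρ q` alone
  -- would not determine them.
  record _≼_ (p q : Polynomial k) : Set where
    constructor wrap-≤
    field unwrap-≤ : eval ρ p ≤ eval ρ q

  record _≋_ (p q : Polynomial k) : Set where
    constructor wrap-≃
    field unwrap-≃ : eval ρ p ≃ eval ρ q

  open _≼_ public
  open _≋_ public

  private
    seq-difference : ∀ {a b p q} → normalise (a :- b) ≡ normalise (p :- q) → ∀ n →
                     seq (eval ρ a) n ℚ.- seq (eval ρ b) n ≡ seq (eval ρ p) n ℚ.- seq (eval ρ q) n
    seq-difference {a} {b} {p} {q} eq n = trans (seq-eval ρ (a :- b) n) (trans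
      (prove ρₙ (a :- b) (p :- q) (cong (λ z → ⟦ z ⟧N ρₙ) eq))
      (sym (seq-eval ρ (p :- q) n)))
      where ρₙ = Vec.map (λ x → seq x n) ρ

  -- Normal forms are compared by computation: a use supplies a nonnegative combination of known
  -- inequalities, and `refl` checks that it has the same difference of sides as the goal.
  linear-≤ : ∀ {a b p q} → p ≼ q → normalise (a :- b) ≡ normalise (p :- q) → a ≼ b
  linear-≤ {a} {b} {p} {q} (wrap-≤ p≤q) eq = wrap-≤
    (≤-via {eval ρ a} {eval ρ b} {eval ρ p} {eval ρ q} p≤q (seq-difference {a} {b} {p} {q} eq))

  linear-≃ : ∀ {a b p q} → p ≋ q → normalise (a :- b) ≡ normalise (p :- q) → a ≋ b
  linear-≃ {a} {b} {p} {q} (wrap-≃ p≃q) eq = wrap-≃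
    (≃-via {eval ρ a} {eval ρ b} {eval ρ p} {eval ρ q} p≃q (seq-difference {a} {b} {p} {q} eq))

  constants : ∀ {p q} → p ℚ.≤ q → con p ≼ con q
  constants p≤q = wrap-≤ (fromℚ-mono-≤ p≤q)

  ≼-trans : ∀ {p q s} → p ≼ q → q ≼ s → p ≼ s
  ≼-trans {p} {q} {s} (wrap-≤ p≤q) (wrap-≤ q≤s) = wrap-≤ (≤-trans {eval ρ p} {eval ρ q} {eval ρ s} p≤q q≤s)

  ≋⇒≼ : ∀ {p q} → p ≋ q → p ≼ q
  ≋⇒≼ {p} {q} (wrap-≃ p≃q) = wrap-≤ (≃⇒≤ {eval ρ p} {eval ρ q} p≃q)

  ≋⇒≽ : ∀ {p q} → p ≋ q → q ≼ p
  ≋⇒≽ {p} {q} (wrap-≃ p≃q) = wrap-≤ (≃⇒≥ {eval ρ p} {eval ρ q} p≃q)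

  _⊞_ : ∀ {p q s t} → p ≼ q → s ≼ t → p :+ s ≼ q :+ t
  _⊞_ {p} {q} {s} {t} (wrap-≤ p≤q) (wrap-≤ s≤t) =
    wrap-≤ (+-mono-≤ {eval ρ p} {eval ρ q} {eval ρ s} {eval ρ t} p≤q s≤t)

  ≽0-* : ∀ {p q} → con 0ℚ ≼ p → con 0ℚ ≼ q → con 0ℚ ≼ p :* q
  ≽0-* {p} {q} (wrap-≤ 0≤p) (wrap-≤ 0≤q) = wrap-≤ (*-nonneg {eval ρ p} {eval ρ q} 0≤p 0≤q)

  _⊡_ : ∀ {c p q} → con 0ℚ ≼ c → p ≼ q → c :* p ≼ c :* q
  _⊡_ {c} {p} {q} (wrap-≤ 0≤c) (wrap-≤ p≤q) = wrap-≤ (*-monoˡ-≤ (eval ρ c) {eval ρ p} {eval ρ q} 0≤c p≤q)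

  ≼-* : ∀ {p q s t} → con 0ℚ ≼ p → con 0ℚ ≼ t → p ≼ q → s ≼ t → p :* s ≼ q :* t
  ≼-* {p} {q} {s} {t} (wrap-≤ 0≤p) (wrap-≤ 0≤t) (wrap-≤ p≤q) (wrap-≤ s≤t) =
    wrap-≤ (*-mono-≤ {eval ρ p} {eval ρ q} {eval ρ s} {eval ρ t} 0≤p 0≤t p≤q s≤t)

  ≋-* : ∀ c {p q} → p ≋ q → c :* p ≋ c :* q
  ≋-* c {p} {q} (wrap-≃ p≃q) = wrap-≃ (*-congˡ (eval ρ c) {eval ρ p} {eval ρ q} p≃q)

  ≼-square-cancel : ∀ {p q} → con 0ℚ ≼ q → p :* p ≼ q :* q → p ≼ q
  ≼-square-cancel {p} {q} (wrap-≤ 0≤q) (wrap-≤ p²≤q²) = wrap-≤ (square-cancel-≤ {eval ρ p} {eval ρ q} 0≤q p²≤q²)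

-- One step of the recursion.

2ℝ : ℝ
2ℝ = fromℚ (fromℕ 2)

-- At time κ: x = 1 - w_κ, and P is the product of the first κ factors.
record Invariant (r : ℝ) (κ : ℚ) (x P : ℝ) : Set where
  field
    ½≤x   : ½ℝ ≤ x
    0≤P   : 0ℝ ≤ P
    x²≤   : x * x ≤ fromℚ (½ ℚ.* ½) + fromℚ κ * (2ℝ * r)
    ≤x²   : fromℚ (½ ℚ.* ½) + fromℚ κ * (2ℝ * r) ≤ x * x + fromℚ κ * ((2ℝ * r) * (2ℝ * r))
    ½≤Px  : ½ℝ ≤ P * x
    Px≤   : P * x ≤ ½ℝ + fromℚ κ * ((4ℝ * r) * (4ℝ * r) * (P * x))

-- The root and its inverse enter only through `s * s ≃ disc r v`, `s * i ≃ 1ℝ` and nonnegativity,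
-- which reduces the step to algebra in six variables.
module Step (r v s i P : ℝ) (κ : ℚ) (0≤κ : 0ℚ ℚ.≤ κ) (0≤r : 0ℝ ≤ r)
            (0≤s : 0ℝ ≤ s) (s²≃disc : s * s ≃ disc r v) (0≤i : 0ℝ ≤ i) (si≃1 : s * i ≃ 1ℝ)
            (invariant : Invariant r κ (1ℝ - v) P) where

  open Inequalities (r ∷ v ∷ s ∷ i ∷ P ∷ fromℚ κ ∷ [])
  private module inv = Invariant invariant

  private
    R V S I p K x x' d f 2r 4r : Polynomial 6
    R  = var 0F
    V  = var 1F
    S  = var 2F
    I  = var 3F
    p  = var 4F
    K  = var 5F
    x  = con 1ℚ :- V
    x' = con 1ℚ :- con ½ :* (con 1ℚ :+ V :- S)
    d  = x' :- x
    f  = con ½ :* (con 1ℚ :+ x :* I)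
    2r = con (fromℕ 2) :* R
    4r = con (fromℕ 4) :* R

  0≼I : con 0ℚ ≼ I
  0≼I = wrap-≤ 0≤i

  0≼K : con 0ℚ ≼ K
  0≼K = wrap-≤ (fromℚ-mono-≤ 0≤κ)

  0≼½ : con 0ℚ ≼ con ½
  0≼½ = constants (ℚ.nonNegative⁻¹ ½)

  0≼2 : con 0ℚ ≼ con (fromℕ 2)
  0≼2 = constants (fromℕ≥0 2)

  0≼2r : con 0ℚ ≼ 2r
  0≼2r = ≽0-* 0≼2 (wrap-≤ 0≤r)

  0≼4r : con 0ℚ ≼ 4r
  0≼4r = ≽0-* (constants (fromℕ≥0 4)) (wrap-≤ 0≤r)

  ½≼x : con ½ ≼ x
  ½≼x = wrap-≤ inv.½≤x

  0≼x : con 0ℚ ≼ x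
  0≼x = ≼-trans 0≼½ ½≼x

  s² : S :* S ≋ x :* x :+ 4r
  s² = wrap-≃ s²≃disc

  si : S :* I ≋ con 1ℚ
  si = wrap-≃ si≃1

  x≼s : x ≼ S
  x≼s = ≼-square-cancel (wrap-≤ 0≤s) (linear-≤ (0≼4r ⊞ ≋⇒≽ s²) refl)

  0≼d : con 0ℚ ≼ d
  0≼d = linear-≤ (0≼½ ⊡ x≼s) refl

  -- `d` is (s - x)/2 and `x'` is (s + x)/2, so the product is a quarter of s² - x² = 4r.
  dx' : d :* x' ≋ R
  dx' = linear-≃ (≋-* (con (½ ℚ.* ½)) s²) refl

  ½≼x' : con ½ ≼ x'
  ½≼x' = linear-≤ (½≼x ⊞ 0≼d) refl

  -- From `x'` ≥ 1/2 follows d/2 ≤ d x' = r.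
  d≼2r : d ≼ 2r
  d≼2r = linear-≤ (0≼2 ⊡ (≼-trans (0≼d ⊡ ½≼x') (≋⇒≼ dx'))) refl

  d²≼4r² : d :* d ≼ 2r :* 2r
  d²≼4r² = ≼-* 0≼d 0≼2r d≼2r d≼2r

  -- Expanding x = x' - d leaves the cross term 2 d x' = 2r.
  x'² : x' :* x' :+ d :* d ≋ x :* x :+ 2r
  x'² = linear-≃ (≋-* (con (fromℕ 2)) dx') refl

  x'²≼ : x' :* x' ≼ con (½ ℚ.* ½) :+ (con 1ℚ :+ K) :* 2r
  x'²≼ = linear-≤ (≋⇒≼ x'² ⊞ ≽0-* 0≼d 0≼d ⊞ wrap-≤ {x :* x} {con (½ ℚ.* ½) :+ K :* 2r} inv.x²≤) refl

  -- The step loses d² ≤ (2r)², which raises the error coefficient from κ to 1 + κ.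
  ≼x'² : con (½ ℚ.* ½) :+ (con 1ℚ :+ K) :* 2r ≼ x' :* x' :+ (con 1ℚ :+ K) :* (2r :* 2r)
  ≼x'² = linear-≤
    (≋⇒≽ x'² ⊞ d²≼4r² ⊞ wrap-≤ {con (½ ℚ.* ½) :+ K :* 2r} {x :* x :+ K :* (2r :* 2r)} inv.≤x²) refl

  0≼p : con 0ℚ ≼ p
  0≼p = wrap-≤ inv.0≤P

  0≼pI : con 0ℚ ≼ p :* I
  0≼pI = ≽0-* 0≼p 0≼I

  0≼f : con 0ℚ ≼ f
  0≼f = linear-≤ (0≼½ ⊞ 0≼½ ⊡ ≽0-* 0≼x 0≼I) refl

  -- f = x'/s and x'² - x s = d².
  pfx' : p :* f :* x' ≋ p :* x :+ p :* I :* (d :* d)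
  pfx' = linear-≃ (≋-* (p :* x :- con ½ :* p :* x') si) refl

  px≼pfx' : p :* x ≼ p :* f :* x'
  px≼pfx' = linear-≤ (≽0-* 0≼pI (≽0-* 0≼d 0≼d) ⊞ ≋⇒≽ pfx') refl

  -- 4r² is a quarter of (4r)², and 1/4 ≤ x'². The factor x'² is introduced so that the error P d²/s
  -- becomes a multiple of P f x', using f = x'/s.
  d²≼16r²x'² : d :* d ≼ 4r :* 4r :* (x' :* x')
  d²≼16r²x'² = linear-≤
    (d²≼4r² ⊞ ≽0-* 0≼4r 0≼4r ⊡ ≼-* 0≼½ (≼-trans 0≼½ ½≼x') ½≼x' ½≼x') refl

  pfx'≼ : p :* f :* x' ≼ p :* x :+ 4r :* 4r :* (p :* f :* x')
  pfx'≼ = linear-≤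
    (≋⇒≼ pfx' ⊞ 0≼pI ⊡ d²≼16r²x'² ⊞ ≋⇒≼ (≋-* (con ½ :* (4r :* 4r) :* p :* x') si)) refl

  -- P x does not decrease, so the error κ (4r)² P x accumulated so far may be charged at the new
  -- value P f x'.
  pfx'≼½+ : p :* f :* x' ≼ con ½ :+ (con 1ℚ :+ K) :* (4r :* 4r :* (p :* f :* x'))
  pfx'≼½+ = linear-≤
    (pfx'≼ ⊞ wrap-≤ {p :* x} {con ½ :+ K :* (4r :* 4r :* (p :* x))} inv.Px≤
           ⊞ ≽0-* 0≼K (≽0-* 0≼4r 0≼4r) ⊡ px≼pfx') refl

  invariant-step : Invariant r (1ℚ ℚ.+ κ) (1ℝ - ½ℝ * (1ℝ + v - s)) (P * (½ℝ * (1ℝ + (1ℝ - v) * i)))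
  invariant-step = record
    { ½≤x  = unwrap-≤ ½≼x'
    ; 0≤P  = unwrap-≤ (≽0-* 0≼p 0≼f)
    ; x²≤  = unwrap-≤ x'²≼
    ; ≤x²  = unwrap-≤ ≼x'²
    ; ½≤Px = unwrap-≤ (≼-trans (wrap-≤ {con ½} {p :* x} inv.½≤Px) px≼pfx')
    ; Px≤  = unwrap-≤ pfx'≼½+
    }

-- Bounds on the product at the last index.

-- Here 4r = 1/m, κ = m - 1, t = √3 and q = 1/√3.
module Endpoint (r x P t q : ℝ) (κ δ : ℚ) (0≤r : 0ℝ ≤ r) (4r≤½ : 4ℝ * r ≤ ½ℝ)
                (κ4r+4r≃1 : fromℚ κ * (4ℝ * r) + 4ℝ * r ≃ 1ℝ) (invariant : Invariant r κ x P)
                (t²≃3 : t * t ≃ 3ℝ) (tq≃1 : t * q ≃ 1ℝ) (0≤q : 0ℝ ≤ q)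
                (0≤δ : 0ℚ ℚ.≤ δ) (24r≤δ : fromℚ (fromℕ 6) * (4ℝ * r) ≤ fromℚ δ) where

  open Inequalities (r ∷ x ∷ P ∷ t ∷ q ∷ fromℚ κ ∷ fromℚ δ ∷ [])
  private
    module inv = Invariant invariant
    X p T Q K D a 2r ¼ ⅓ ¾ 4/3 : Polynomial 7
    X   = var 1F
    p   = var 2F
    T   = var 3F
    Q   = var 4F
    K   = var 5F
    D   = var 6F
    a   = con (fromℕ 4) :* var 0F
    2r  = con (fromℕ 2) :* var 0F
    ¼   = con (½ ℚ.* ½)
    ⅓   = con (1/suc 2)
    ¾   = con (fromℕ 3 ℚ.* (½ ℚ.* ½))
    4/3 = con (fromℕ 4 ℚ.* 1/suc 2)

  0≼½ : con 0ℚ ≼ con ½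
  0≼½ = constants (ℚ.nonNegative⁻¹ ½)

  0≼¼ : con 0ℚ ≼ ¼
  0≼¼ = constants (ℚ.nonNegative⁻¹ (½ ℚ.* ½))

  0≼¾ : con 0ℚ ≼ ¾
  0≼¾ = constants (ℚ.nonNegative⁻¹ (fromℕ 3 ℚ.* (½ ℚ.* ½)))

  0≼4/3 : con 0ℚ ≼ 4/3
  0≼4/3 = constants (ℚ.nonNegative⁻¹ (fromℕ 4 ℚ.* 1/suc 2))

  0≼2 : con 0ℚ ≼ con (fromℕ 2)
  0≼2 = constants (fromℕ≥0 2)

  0≼a : con 0ℚ ≼ a
  0≼a = ≽0-* (constants (fromℕ≥0 4)) (wrap-≤ 0≤r)

  a≼½ : a ≼ con ½
  a≼½ = wrap-≤ 4r≤½

  Ka+a : K :* a :+ a ≋ con 1ℚ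
  Ka+a = wrap-≃ κ4r+4r≃1

  ½≼X : con ½ ≼ X
  ½≼X = wrap-≤ inv.½≤x

  0≼p : con 0ℚ ≼ p
  0≼p = wrap-≤ inv.0≤P

  0≼p² : con 0ℚ ≼ p :* p
  0≼p² = ≽0-* 0≼p 0≼p

  ½≼pX : con ½ ≼ p :* X
  ½≼pX = wrap-≤ inv.½≤Px

  0≼pX : con 0ℚ ≼ p :* X
  0≼pX = ≼-trans 0≼½ ½≼pX

  T² : T :* T ≋ con (fromℕ 3)
  T² = wrap-≃ t²≃3

  TQ : T :* Q ≋ con 1ℚ
  TQ = wrap-≃ tq≃1

  0≼Q : con 0ℚ ≼ Q
  0≼Q = wrap-≤ 0≤q

  0≼D : con 0ℚ ≼ D
  0≼D = wrap-≤ (fromℚ-mono-≤ 0≤δ)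

  -- q² - 1/3 equals (tq + 1)(tq - 1)/3 + q²(3 - t²)/3, and both terms vanish.
  Q²≼⅓ : Q :* Q ≼ ⅓
  Q²≼⅓ = linear-≤ (≋⇒≼ (≋-* (⅓ :* (T :* Q :+ con 1ℚ)) TQ) ⊞ ≋⇒≽ (≋-* (⅓ :* (Q :* Q)) T²)) refl

  ⅓≼Q² : ⅓ ≼ Q :* Q
  ⅓≼Q² = linear-≤ (≋⇒≽ (≋-* (⅓ :* (T :* Q :+ con 1ℚ)) TQ) ⊞ ≋⇒≼ (≋-* (⅓ :* (Q :* Q)) T²)) refl

  ½≼Q : con ½ ≼ Q
  ½≼Q = ≼-square-cancel 0≼Q (linear-≤ (⅓≼Q² ⊞ constants (from-yes (½ ℚ.* ½ ℚ.≤? 1/suc 2))) refl)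

  -- With `a` = 4r and K a = 1 - a, the upper bound on X² is 1/4 + (1 - a)/2 ≤ 3/4, so 1/4 ≤ P² X² ≤
  -- 3P²/4.
  ⅓≼p² : ⅓ ≼ p :* p
  ⅓≼p² = linear-≤ (0≼4/3 ⊡
    (≼-* 0≼½ 0≼pX ½≼pX ½≼pX
      ⊞ 0≼p² ⊡ wrap-≤ {X :* X} {¼ :+ K :* 2r} inv.x²≤
      ⊞ ≋⇒≼ (≋-* (con ½ :* (p :* p)) Ka+a)
      ⊞ 0≼½ ⊡ ≽0-* 0≼a 0≼p²)) refl

  -- K a² = a(1 - a) is at most a.
  pX≼½+apX : p :* X ≼ con ½ :+ a :* (p :* X)
  pX≼½+apX = linear-≤
    (wrap-≤ {p :* X} {con ½ :+ K :* (a :* a :* (p :* X))} inv.Px≤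
      ⊞ ≋⇒≼ (≋-* (a :* (p :* X)) Ka+a) ⊞ ≽0-* 0≼a (≽0-* 0≼a 0≼pX)) refl

  -- A crude bound from a ≤ 1/2; inserted back into `pX≼½+apX`, it gives the sharper `pX≼½+a`.
  pX≼1 : p :* X ≼ con 1ℚ
  pX≼1 = linear-≤ (0≼2 ⊡ (pX≼½+apX ⊞ 0≼pX ⊡ a≼½)) refl

  pX≼½+a : p :* X ≼ con ½ :+ a
  pX≼½+a = linear-≤ (pX≼½+apX ⊞ 0≼a ⊡ pX≼1) refl

  p≼2 : p ≼ con (fromℕ 2)
  p≼2 = linear-≤ (0≼2 ⊡ ≼-trans (0≼p ⊡ ½≼X) pX≼1) refl

  -- The lower bound on X² gives 3P²/4 ≤ (1/2 + a)² + 3aP²/4. By a² ≤ a/2 and P² ≤ 4 the right side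
  -- is at most 1/4 + 9a/2; multiplying by 4/3 yields the constant 6.
  p²≼⅓+6a : p :* p ≼ ⅓ :+ con (fromℕ 6) :* a
  p²≼⅓+6a = linear-≤ (0≼4/3 ⊡
    (≼-* 0≼pX (≼-trans 0≼pX pX≼½+a) pX≼½+a pX≼½+a
      ⊞ 0≼p² ⊡ wrap-≤ {¼ :+ K :* 2r} {X :* X :+ K :* (2r :* 2r)} inv.≤x²
      ⊞ ≋⇒≼ (≋-* (¼ :* a :* (p :* p) :- con ½ :* (p :* p)) Ka+a)
      ⊞ 0≼¼ ⊡ ≽0-* (≽0-* 0≼a 0≼a) 0≼p²
      ⊞ 0≼a ⊡ a≼½
      ⊞ ≽0-* 0≼¾ 0≼a ⊡ ≼-* 0≼p 0≼2 p≼2 p≼2)) refl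

  q≤P : q ≤ P
  q≤P = unwrap-≤ (≼-square-cancel {Q} {p} 0≼p (≼-trans Q²≼⅓ ⅓≼p²))

  -- P² ≤ q² + δ, and δ ≤ 2δq because q ≥ 1/2, so P² ≤ (q + δ)².
  P≤q+δ : P ≤ q + fromℚ δ
  P≤q+δ = unwrap-≤ (≼-square-cancel {p} {Q :+ D} (linear-≤ (0≼Q ⊞ 0≼D) refl) (linear-≤
    (p²≼⅓+6a ⊞ ⅓≼Q² ⊞ wrap-≤ {con (fromℕ 6) :* a} {D} 24r≤δ
      ⊞ ≽0-* 0≼2 0≼D ⊡ ½≼Q ⊞ ≽0-* 0≼D 0≼D) refl))

-- The invariant along the orbit.

-- At x = 1/2 and P = 1 every bound except 0 ≤ P is an equality, hence follows from 0 ≤ 0.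
invariant-start : ∀ r → Invariant r 0ℚ (1ℝ - ½ℝ) 1ℝ
invariant-start r = record
  { ½≤x  = unwrap-≤ {con ½} {con 1ℚ :- con ½} (linear-≤ 0≼0 refl)
  ; 0≤P  = fromℚ-mono-≤ (ℚ.nonNegative⁻¹ 1ℚ)
  ; x²≤  = unwrap-≤ {x :* x} {¼ :+ con 0ℚ :* 2R} (linear-≤ 0≼0 refl)
  ; ≤x²  = unwrap-≤ {¼ :+ con 0ℚ :* 2R} {x :* x :+ con 0ℚ :* (2R :* 2R)} (linear-≤ 0≼0 refl)
  ; ½≤Px = unwrap-≤ {con ½} {con 1ℚ :* x} (linear-≤ 0≼0 refl)
  ; Px≤  = unwrap-≤ {con 1ℚ :* x} {con ½ :+ con 0ℚ :* (4R :* 4R :* (con 1ℚ :* x))} (linear-≤ 0≼0 refl)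
  }
  where
  open Inequalities (r ∷ [])
  x ¼ 2R 4R : Polynomial 1
  x  = con 1ℚ :- con ½
  ¼  = con (½ ℚ.* ½)
  2R = con (fromℕ 2) :* var 0F
  4R = con (fromℕ 4) :* var 0F
  0≼0 : con 0ℚ ≼ con 0ℚ
  0≼0 = constants ℚ.≤-refl

-- The record is rebuilt, here and below, because its fields only mention terms of
-- sequences, whereas equating its parameters would compare moduli of convergence.
Ψ-invariant : ∀ r (0<r : 0ℝ < r) v P κ → 0ℚ ℚ.≤ κ → Invariant r κ (1ℝ - v) P →
              Invariant r (1ℚ ℚ.+ κ) (1ℝ - Ψ r v) (P * ∂Ψ r 0<r v)
Ψ-invariant r 0<r v P κ 0≤κ inv = record { Invariant step }
  where
  Δ   = disc r v
  0<Δ = disc-pos r v 0<r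
  i   = inverse (√ Δ) (√-pos Δ 0<Δ)
  step : Invariant r (1ℚ ℚ.+ κ) (1ℝ - ½ℝ * (1ℝ + v - √ Δ)) (P * (½ℝ * (1ℝ + (1ℝ - v) * i)))
  step = Step.invariant-step r v (√ Δ) i P κ
      0≤κ (<⇒≤ {0ℝ} {r} 0<r) (√-nonneg Δ) (√-square Δ (<⇒≤ {0ℝ} {Δ} 0<Δ))
      (inverse-nonneg (√ Δ) (√-pos Δ 0<Δ)) (inverse-correct (√ Δ) (√-pos Δ 0<Δ)) inv

module _ (m : ℕ) .{{nt : NonTrivial m}} where

  partial-product : ℕ → ℝ
  partial-product n = ∏[k< n ] (λ k → ∂Ψ (r m {{nt}}) (r-pos m {{nt}}) (w m {{nt}} k))

  orbit-invariant : ∀ n → Invariant (r m {{nt}}) (fromℕ n) (1ℝ - w m {{nt}} n) (partial-product n)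
  orbit-invariant zero    = record { Invariant (invariant-start (r m {{nt}})) }
  -- The step ends at `1ℚ + fromℕ n`, equal to `fromℕ (suc n)` only propositionally.
  orbit-invariant (suc n) = subst (λ κ → Invariant (r m {{nt}}) κ (1ℝ - w m {{nt}} (suc n)) (partial-product (suc n)))
    (sym (fromℕ-+ 1 n))
    (record { Invariant (Ψ-invariant (r m {{nt}}) (r-pos m {{nt}}) (w m {{nt}} n) (partial-product n)
      (fromℕ n) (fromℕ≥0 n) (orbit-invariant n)) })

-- Specialisation to 4r = 1/m.

0<3 : 0ℝ < 3ℝ
0<3 = fromℕ 3 , ℚ.positive⁻¹ (fromℕ 3) , 0 , λ _ _ → ℚ.≤-refl

module _ (n : ℕ) .{{nt : NonTrivial (suc n)}} where

  4r≡1/m : ∀ k → seq (4ℝ * r (suc n) {{nt}}) k ≡ 1/suc n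
  4r≡1/m k = 4*1/4m (suc n)

  [m-1]4r+4r≃1 : fromℚ (fromℕ n) * (4ℝ * r (suc n) {{nt}}) + 4ℝ * r (suc n) {{nt}} ≃ 1ℝ
  [m-1]4r+4r≃1 ε 0<ε = 0 , λ k _ → subst (λ z → ℚ.∣ z ℚ.- 1ℚ ∣ ℚ.≤ ε) (sym (eq k)) (ℚ.<⇒≤ 0<ε)
    where
    open ℚ.≤-Reasoning
    eq : ∀ k → seq (fromℚ (fromℕ n) * (4ℝ * r (suc n) {{nt}}) + 4ℝ * r (suc n) {{nt}}) k ≡ 1ℚ
    eq k = begin-equality
      fromℕ n ℚ.* seq (4ℝ * r (suc n) {{nt}}) k ℚ.+ seq (4ℝ * r (suc n) {{nt}}) k
                                                           ≡⟨ cong (λ z → fromℕ n ℚ.* z ℚ.+ z) (4r≡1/m k) ⟩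
      fromℕ n ℚ.* 1/suc n ℚ.+ 1/suc n                      ≡⟨ solve 2 (λ n y → n :* y :+ y := (con 1ℚ :+ n) :* y) refl (fromℕ n) (1/suc n) ⟩
      (1ℚ ℚ.+ fromℕ n) ℚ.* 1/suc n                         ≡⟨ cong (ℚ._* 1/suc n) (sym (fromℕ-+ 1 n)) ⟩
      fromℕ (suc n) ℚ.* 1/suc n                            ≡⟨ 1/suc-inverse n ⟩
      1ℚ                                                   ∎

  module _ (δ : ℚ) (0<δ : 0ℚ ℚ.< δ) (1/m≤½ : 1/suc n ℚ.≤ ½) (6/m≤δ : fromℕ 6 ℚ.* 1/suc n ℚ.≤ δ) where

    private
      module E = Endpoint (r (suc n) {{nt}}) (1ℝ - w (suc n) {{nt}} n) (partial-product (suc n) {{nt}} n) (√ 3ℝ) 1/√3 (fromℕ n) δ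
        (<⇒≤ {0ℝ} {r (suc n) {{nt}}} (r-pos (suc n) {{nt}}))
        (pointwise-≤ {4ℝ * r (suc n) {{nt}}} {½ℝ} λ k → subst (ℚ._≤ ½) (sym (4r≡1/m k)) 1/m≤½)
        [m-1]4r+4r≃1 (orbit-invariant (suc n) {{nt}} n)
        (√-square 3ℝ (<⇒≤ {0ℝ} {3ℝ} 0<3)) (inverse-correct (√ 3ℝ) (√-pos 3ℝ 0<3)) (inverse-nonneg (√ 3ℝ) (√-pos 3ℝ 0<3))
        (ℚ.<⇒≤ 0<δ)
        (pointwise-≤ {fromℚ (fromℕ 6) * (4ℝ * r (suc n) {{nt}})} {fromℚ δ} λ k →
          subst (λ z → fromℕ 6 ℚ.* z ℚ.≤ δ) (sym (4r≡1/m k)) 6/m≤δ)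

    -- For m = `suc n` the product has `n` = m - 1 factors, so the invariant is used at index `n`,
    -- one past the last factor.
    1/√3≤p⊤ : 1/√3 ≤ p⊤ (suc n) {{nt}}
    1/√3≤p⊤ = E.q≤P

    p⊤≤1/√3+δ : p⊤ (suc n) {{nt}} ≤ 1/√3 + fromℚ δ
    p⊤≤1/√3+δ = E.P≤q+δ

-- Convergence.

-- Strict order needs a uniform rational gap. Of `δ`, one quarter is the assumed distance, one
-- quarter the slack of `≤`, and the remaining half is the gap.
∣-∣-< : ∀ {x y ε δ} → 0ℚ ℚ.< δ → Eventually (λ n → δ ℚ.≤ seq ε n) → y ≤ x →
        x ≤ y + fromℚ (½ ℚ.* (½ ℚ.* δ)) → ∣ x - y ∣ < ε
∣-∣-< {x} {y} {ε} {δ} 0<δ δ≤ε y≤x x≤y+η = ½ ℚ.* δ , half>0 0<δ , eventually₂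
  (λ { n δ≤ (y≤ , x≤) → begin
    ℚ.∣ seq x n ℚ.- seq y n ∣ ℚ.+ ½ ℚ.* δ    ≤⟨ ℚ.+-monoˡ-≤ (½ ℚ.* δ) (∣-∣-≤ {seq x n} {seq y n} (x≤+ n x≤) (y≤+ n y≤)) ⟩
    ½ ℚ.* δ ℚ.+ ½ ℚ.* δ                      ≡⟨ halves δ ⟩
    δ                                        ≤⟨ δ≤ ⟩
    seq ε n                                  ∎ })
  δ≤ε (eventually₂ (λ _ → _,_) (y≤x η 0<η) (x≤y+η η 0<η))
  where
  open ℚ.≤-Reasoning
  η = ½ ℚ.* (½ ℚ.* δ)
  0<η : 0ℚ ℚ.< η
  0<η = half>0 (half>0 0<δ)
  x≤+ : ∀ n → seq x n ℚ.≤ seq y n ℚ.+ η ℚ.+ η → seq x n ℚ.≤ seq y n ℚ.+ ½ ℚ.* δ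
  x≤+ n x≤ = begin
    seq x n                      ≤⟨ x≤ ⟩
    seq y n ℚ.+ η ℚ.+ η          ≡⟨ ℚ.+-assoc (seq y n) η η ⟩
    seq y n ℚ.+ (η ℚ.+ η)        ≡⟨ cong (seq y n ℚ.+_) (halves (½ ℚ.* δ)) ⟩
    seq y n ℚ.+ ½ ℚ.* δ          ∎
  y≤+ : ∀ n → seq y n ℚ.≤ seq x n ℚ.+ η → seq y n ℚ.≤ seq x n ℚ.+ ½ ℚ.* δ
  y≤+ n y≤ = begin
    seq y n                      ≤⟨ y≤ ⟩
    seq x n ℚ.+ η                ≡⟨ sym (ℚ.+-identityʳ (seq x n ℚ.+ η)) ⟩
    seq x n ℚ.+ η ℚ.+ 0ℚ         ≤⟨ ℚ.+-monoʳ-≤ (seq x n ℚ.+ η) (ℚ.<⇒≤ 0<η) ⟩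
    seq x n ℚ.+ η ℚ.+ η          ≡⟨ ℚ.+-assoc (seq x n) η η ⟩
    seq x n ℚ.+ (η ℚ.+ η)        ≡⟨ cong (seq x n ℚ.+_) (halves (½ ℚ.* δ)) ⟩
    seq x n ℚ.+ ½ ℚ.* δ          ∎

theorem4 : (ε : ℝ) → 0ℝ < ε →
    ∃[ M ] ((m : ℕ) → .{{_ : NonTrivial m}} → M ℕ.≤ m → ∣ p⊤ m - 1/√3 ∣ < ε)
-- The threshold in `small` is for `n` with m = `suc n`, hence the shift by one.
theorem4 ε (δ , 0<δ , N , ε≥δ) = suc (proj₁ small) , close
  where
  η = ½ ℚ.* (½ ℚ.* δ)
  0<η : 0ℚ ℚ.< η
  0<η = half>0 (half>0 0<δ)
  ⅙ = 1/suc 5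
  -- 1/m ≤ 1/2 gives 4r ≤ 1/2 in `Endpoint`, and 1/m ≤ η/6 absorbs the error 6/m.
  small : Eventually (λ n → 1/suc n ℚ.≤ ½ ℚ.⊓ (⅙ ℚ.* η))
  small = 1/suc-small (⊓->0 (ℚ.positive⁻¹ ½) (*->0 (1/suc>0 5) 0<η))
  6/m≤η : ∀ n → 1/suc n ℚ.≤ ½ ℚ.⊓ (⅙ ℚ.* η) → fromℕ 6 ℚ.* 1/suc n ℚ.≤ η
  6/m≤η n le = begin
    fromℕ 6 ℚ.* 1/suc n         ≤⟨ ℚ.*-monoˡ-≤-nonNeg (fromℕ 6) (ℚ.≤-trans le (ℚ.p⊓q≤q ½ (⅙ ℚ.* η))) ⟩
    fromℕ 6 ℚ.* (⅙ ℚ.* η)       ≡⟨ sym (ℚ.*-assoc (fromℕ 6) ⅙ η) ⟩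
    1ℚ ℚ.* η                    ≡⟨ ℚ.*-identityˡ η ⟩
    η                           ∎
    where open ℚ.≤-Reasoning
  close : (m : ℕ) → .{{nt : NonTrivial m}} → suc (proj₁ small) ℕ.≤ m → ∣ p⊤ m {{nt}} - 1/√3 ∣ < ε
  close (suc n) {{nt}} (ℕ.s≤s N≤n) = ∣-∣-< {p⊤ (suc n) {{nt}}} {1/√3} {ε} 0<δ
    (N , λ k N≤k → subst (ℚ._≤ seq ε k) (ℚ.+-identityˡ δ) (ε≥δ k N≤k))
    (1/√3≤p⊤ n {{nt}} η 0<η 1/m≤½ (6/m≤η n 1/m≤)) (p⊤≤1/√3+δ n {{nt}} η 0<η 1/m≤½ (6/m≤η n 1/m≤))
    where
    1/m≤ = proj₂ small n N≤n
    1/m≤½ : 1/suc n ℚ.≤ ½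
    1/m≤½ = ℚ.≤-trans 1/m≤ (ℚ.p⊓q≤p ½ (⅙ ℚ.* η))
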